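{- If $C=\sum_{j=1}^kT_j$ is a simple and minimal $\Sigma\Pi\Sigma(k,d)$ identity, then every maximal chain of form-ideals $\mathcal{T}$ for $C$ has length $\#\mathcal{T}\le\binom{k}{2}(\log_2d+3)+(k-1)$.
   Context: Notation: $R=\mathbb{F}[x_1,\dots,x_n]$; linear forms $\sum_ia_ix_i$; $sp(X)$ is the span of a set $X$ of forms; $T_j=\alpha_jM(L(T_j))$ with $\alpha_j\in\mathbb{F}^*$, $L(T_j)$ the list of $d$ linear forms of $T_j$, $M(W)=\prod_{\ell\in W}\ell$; $L(C)$ is the union of the lists $L(T_j)$. $C$ simple: no nonzero linear form divides all $T_j$; minimal: $\sum_{j\in S}T_j\ne0$ for every proper subset $S\subsetneq[k]$; identity: $\sum_jT_j=0$. An ordered form-ideal is an ordered set $I=\{v_1,\dots,v_i\}$ of linearly independent linear forms; with $v_0=0$, $sp_j=sp(v_0,\dots,v_j)$, an ordered $I$-matching between lists $U,V$ is a bijection $\pi$ with $\pi(\ell)=c\ell+w$, $c\in\mathbb{F}^*$, $w\in sp_j$ for some $j$ with $\ell\notin sp_j$; the (unique) such $c=d_\ell$ gives scaling factor $sc(\pi)=\prod_{\ell\in U}d_\ell$. For a set $S$ of linear forms, $I$ is orthogonal to $S$ if $sp(S)\cap sp(I)=\{0\}$, and such $I$ is useful in $C$ w.r.t. $S$ if there is $Q\subset[k]$, $1<\#Q<k$ (a blocking subset of $C,S,I$) such that, with $V_q$ the sublist of $L(T_q)$ of forms not in $sp(S\cup I)\setminus sp(I)$, there is a list $V$ and ordered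 $I$-matchings $\tau_q:V\to V_q$ ($q\in Q$) with $\sum_{q\in Q}sc(\tau_q)\alpha_qM(L(T_q)\setminus V_q)\equiv0$ modulo the ideal generated by $I$ and each summand nonzero modulo that ideal. A chain of form-ideals for $C$ is an ordered set $\mathcal{T}=\{(C,S_1,I_1,Q_1),\dots,(C,S_m,I_m,Q_m)\}$ with $S_1=\emptyset$, $S_i=S_{i-1}\cup I_{i-1}$ for $2\le i\le m$, each $I_i$ an ordered form-ideal orthogonal to $S_i$ and useful in $C$ w.r.t. $S_i$, and $Q_i$ a blocking subset of $C,S_i,I_i$; $\#\mathcal{T}=m$. It is maximal if $L(C)\subseteq sp(S_m\cup I_m)$. -}

module Defs where

open import Level using (_⊔_)
open import Algebra.Bundles using (CommutativeRing)
open import Data.Bool using (Bool; true; false; if_then_else_)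
open import Data.Nat as ℕ using (ℕ; zero; suc; _∸_)
open import Data.Fin using (Fin)
open import Data.Vec as Vec using (Vec; []; _∷_)
open import Data.List as List using (List; []; _∷_; _++_; length; take)
open import Data.Product using (Σ; ∃; _×_; _,_)
open import Data.Nat.Combinatorics using () renaming (_C_ to _choose_)
open import Data.Fin.Subset using (Subset; ∣_∣)
open import Function.Bundles using (_↔_; _⇔_; Inverse)
open import Relation.Nullary using (¬_)
open import Relation.Binary.PropositionalEquality using (_≡_; refl)

record IsField {c ℓ} (R : CommutativeRing c ℓ) : Set (c ⊔ ℓ) where
  open CommutativeRing R
  field
    0≉1 : ¬ (0# ≈ 1#)
    inverse : ∀ x → ¬ (x ≈ 0#) → ∃ λ y → x * y ≈ 1#

module _ {c ℓ} (R : CommutativeRing c ℓ) (n : ℕ) where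
  open CommutativeRing R using (_≈_; _+_; _*_; 0#; 1#) renaming (Carrier to F)

  LinForm : Set c
  LinForm = Vec F n

  _≈v_ : LinForm → LinForm → Set ℓ
  u ≈v v = ∀ i → Vec.lookup u i ≈ Vec.lookup v i

  0v : LinForm
  0v = Vec.replicate n 0#

  _+v_ : LinForm → LinForm → LinForm
  u +v v = Vec.zipWith _+_ u v

  _·v_ : F → LinForm → LinForm
  a ·v v = Vec.map (a *_) v

  lc : (X : List LinForm) → Vec F (length X) → LinForm
  lc [] [] = 0v
  lc (x ∷ X) (a ∷ as) = (a ·v x) +v lc X as

  InSpan : List LinForm → LinForm → Set (c ⊔ ℓ)
  InSpan X v = Σ (Vec F (length X)) λ as → v ≈v lc X as

  LinIndep : List LinForm → Set (c ⊔ ℓ)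
  LinIndep X = ∀ as → lc X as ≈v 0v → ∀ i → Vec.lookup as i ≈ 0#

  Orthogonal : List LinForm → List LinForm → Set (c ⊔ ℓ)
  Orthogonal S I = ∀ v → InSpan S v → InSpan I v → v ≈v 0v

  -- Polynomials in F[x_1,…,x_n]: syntax, with equality given by equality of
  -- all coefficients.

  data Poly : Set c where
    con : F → Poly
    var : Fin n → Poly
    _⊕_ : Poly → Poly → Poly
    _⊗_ : Poly → Poly → Poly

  Monomial : Set
  Monomial = Vec ℕ n

  private
    allZero : ∀ {m} → Vec ℕ m → Bool
    allZero [] = true
    allZero (zero ∷ xs) = allZero xs
    allZero (suc _ ∷ _) = false

    isUnit : ∀ {m} → Fin m → Vec ℕ m → Bool
    isUnit Fin.zero (1 ∷ xs) = allZero xs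
    isUnit Fin.zero (_ ∷ xs) = false
    isUnit (Fin.suc i) (zero ∷ xs) = isUnit i xs
    isUnit (Fin.suc i) (suc _ ∷ xs) = false

    below : ∀ {m} → Vec ℕ m → List (Vec ℕ m)
    below [] = [] ∷ []
    below (x ∷ xs) =
      List.concatMap (λ i → List.map (i ∷_) (below xs)) (List.upTo (suc x))

    sumF : List F → F
    sumF = List.foldr _+_ 0#

  coeff : Poly → Monomial → F
  coeff (con a) m = if allZero m then a else 0#
  coeff (var i) m = if isUnit i m then 1# else 0#
  coeff (p ⊕ q) m = coeff p m + coeff q m
  coeff (p ⊗ q) m =
    sumF (List.map (λ a → coeff p a * coeff q (Vec.zipWith _∸_ m a)) (below m))

  _≃_ : Poly → Poly → Set ℓ
  p ≃ q = ∀ m → coeff p m ≈ coeff q m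

  sumP : List Poly → Poly
  sumP = List.foldr _⊕_ (con 0#)

  linP : LinForm → Poly
  linP v = sumP (Vec.toList (Vec.zipWith (λ a i → con a ⊗ var i) v (Vec.allFin n)))

  M : List LinForm → Poly
  M = List.foldr (λ l p → linP l ⊗ p) (con 1#)

  Divides : Poly → Poly → Set (c ⊔ ℓ)
  Divides p q = Σ Poly λ g → q ≃ (p ⊗ g)

  InIdeal : List LinForm → Poly → Set (c ⊔ ℓ)
  InIdeal I p = Σ (Vec Poly (length I)) λ gs →
    p ≃ sumP (List.zipWith (λ g v → g ⊗ linP v) (Vec.toList gs) I)

  record Circuit (k d : ℕ) : Set (c ⊔ ℓ) where
    field
      α : Fin k → F
      α≉0 : ∀ j → ¬ (α j ≈ 0#)
      L : Fin k → Vec LinForm d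

    T : Fin k → Poly
    T j = con (α j) ⊗ M (Vec.toList (L j))

  open Circuit public

  subsetSum : ∀ {k} → Subset k → (Fin k → Poly) → Poly
  subsetSum {k} S f =
    sumP (List.map (λ j → if Vec.lookup S j then f j else con 0#) (List.allFin k))

  IsIdentity : ∀ {k d} → Circuit k d → Set ℓ
  IsIdentity {k} C = sumP (List.map (T C) (List.allFin k)) ≃ con 0#

  IsSimple : ∀ {k d} → Circuit k d → Set (c ⊔ ℓ)
  IsSimple C = ∀ (l : LinForm) → ¬ (l ≈v 0v) → ¬ (∀ j → Divides (linP l) (T C j))

  IsMinimal : ∀ {k d} → Circuit k d → Set ℓ
  IsMinimal {k} C = ∀ (S : Subset k) →
    (∃ λ j → Vec.lookup S j ≡ true) → (∃ λ j → Vec.lookup S j ≡ false) →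
    ¬ (subsetSum S (T C) ≃ con 0#)

  record OrdMatching (I U V : List LinForm) : Set (c ⊔ ℓ) where
    field
      π : Fin (length U) ↔ Fin (length V)
      d : Fin (length U) → F
      d≉0 : ∀ u → ¬ (d u ≈ 0#)
      shape : ∀ u → Σ ℕ λ j → Σ LinForm λ w →
        InSpan (take j I) w × ¬ InSpan (take j I) (List.lookup U u) ×
        (List.lookup V (Inverse.to π u) ≈v ((d u ·v List.lookup U u) +v w))

    sc : F
    sc = List.foldr _*_ 1# (List.map d (List.allFin (length U)))

  open OrdMatching public

  keepT : ∀ {m} {A : Set c} → Vec Bool m → Vec A m → List A
  keepT [] [] = []
  keepT (true ∷ bs) (x ∷ xs) = x ∷ keepT bs xs
  keepT (false ∷ bs) (x ∷ xs) = keepT bs xs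

  keepF : ∀ {m} {A : Set c} → Vec Bool m → Vec A m → List A
  keepF [] [] = []
  keepF (true ∷ bs) (x ∷ xs) = keepF bs xs
  keepF (false ∷ bs) (x ∷ xs) = x ∷ keepF bs xs

  record BlockData {k d : ℕ} (C : Circuit k d) (S I V : List LinForm) (q : Fin k)
         : Set (c ⊔ ℓ) where
    field
      -- flags i = true  iff  the i-th form of L(T_q) is not in sp(S ∪ I) \ sp(I);
      -- V_q = keepT flags (L q),  L(T_q) \ V_q = keepF flags (L q)
      flags : Vec Bool d
      flags-spec : ∀ i → (Vec.lookup flags i ≡ true) ⇔
        (¬ (InSpan (S ++ I) (Vec.lookup (L C q) i) × ¬ InSpan I (Vec.lookup (L C q) i)))
      τ : OrdMatching I V (keepT flags (L C q))

    summand : Poly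
    summand = con (sc τ * α C q) ⊗ M (keepF flags (L C q))

  open BlockData public

  private
    pick : (b : Bool) → (b ≡ true → Poly) → Poly
    pick true f = f refl
    pick false f = con 0#

  sumIn : ∀ {k} (Q : Subset k) → ((q : Fin k) → Vec.lookup Q q ≡ true → Poly) → Poly
  sumIn {k} Q f = sumP (List.map (λ q → pick (Vec.lookup Q q) (f q)) (List.allFin k))

  Blocking : ∀ {k d} → Circuit k d → List LinForm → List LinForm → Subset k → Set (c ⊔ ℓ)
  Blocking {k} C S I Q =
    1 ℕ.< ∣ Q ∣ × ∣ Q ∣ ℕ.< k ×
    Σ (List LinForm) λ V →
    Σ ((q : Fin k) → Vec.lookup Q q ≡ true → BlockData C S I V q) λ bd →
      InIdeal I (sumIn Q (λ q e → summand (bd q e))) ×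
      (∀ q e → ¬ InIdeal I (summand (bd q e)))

  Useful : ∀ {k d} → Circuit k d → List LinForm → List LinForm → Set (c ⊔ ℓ)
  Useful {k} C S I = Σ (Subset k) λ Q → Blocking C S I Q

  data ChainFrom {k d} (C : Circuit k d) :
         List LinForm → List (List LinForm × Subset k) → Set (c ⊔ ℓ) where
    []  : ∀ {S} → ChainFrom C S []
    _∷_ : ∀ {S I Q rest} →
          (LinIndep I × Orthogonal S I × Blocking C S I Q) →
          ChainFrom C (S ++ I) rest → ChainFrom C S ((I , Q) ∷ rest)

  Chain : ∀ {k d} → Circuit k d → List (List LinForm × Subset k) → Set (c ⊔ ℓ)
  Chain C 𝒯 = ChainFrom C [] 𝒯

  finalSpan : ∀ {k} → List LinForm → List (List LinForm × Subset k) → List LinForm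
  finalSpan S [] = S
  finalSpan S ((I , _) ∷ rest) = finalSpan (S ++ I) rest

  IsMaximal : ∀ {k d} → Circuit k d → List (List LinForm × Subset k) → Set (c ⊔ ℓ)
  IsMaximal C 𝒯 = ∀ j i → InSpan (finalSpan [] 𝒯) (Vec.lookup (L C j) i)

-- #𝒯 ≤ C(k,2)(log₂ d + 3) + (k − 1), for k, d ≥ 1, written without logarithms:
-- 2^#𝒯 ≤ 2^((k−1) + 3·C(k,2)) · d^C(k,2).
LengthBound : ℕ → ℕ → ℕ → Set
LengthBound k d m = 2 ℕ.^ m ℕ.≤ 2 ℕ.^ ((k ∸ 1) ℕ.+ 3 ℕ.* (k choose 2)) ℕ.* d ℕ.^ (k choose 2)

{-# OPTIONS --safe #-}
-- For a < b cancel a maximal common part, up to scaling of forms, of the lists L(T_a) and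
-- L(T_b), and let D(a,b) be the list of the at most 2d remaining forms.
--
-- (1) Every link (S, I, Q) of the chain has a < b in Q and a form of D(a,b) outside sp(S).
-- Otherwise all L(T_q), q ∈ Q, agree up to scaling outside sp(S).  Replace each form of
-- L(T_q) that occurs in V_q by its leading coefficient, which the ordered matchings scale by
-- exactly their scaling factors, and reduce the others by the projection that kills I and
-- fixes S.  The blocking relation says that the sum of the resulting products vanishes.
-- As the forms that were changed are common to all L(T_q) up to scaling, cross-multiplying
-- yields Σ_{q ∈ Q} T_q = 0, against minimality.
--
-- (2) If a, b ∈ Q, counting the forms congruent to e modulo I shows that each e ∈ D(a,b)
-- outside sp(S ∪ I) has a partner in D(a,b) that is congruent but not proportional to e.
-- If (1) picks the pair (a,b) for r links, then starting from the form of the last one and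
-- doubling along the earlier ones gives 2^(r-1) distinct elements of D(a,b), so 2^r ≤ 4d.
-- The product over all pairs is 2^#𝒯 ≤ (4d)^C(k,2).
--
-- Equality in the field is not decidable, so existence statements are doubly negated; the
-- bound itself is decidable.
module Submission where

open import Defs
open import Level using (Level; _⊔_)
open import Algebra.Bundles using (CommutativeRing)
import Algebra.Properties.CommutativeMonoid.Sum as MonoidSum
import Algebra.Properties.Ring as RingProperties
import Algebra.Solver.Ring.NaturalCoefficients.Default as NaturalCoefficients
open import Data.Bool as Bool using (Bool; true; false; if_then_else_)
open import Data.Empty using (⊥; ⊥-elim)
open import Data.Fin as Fin using (Fin; toℕ)
import Data.Fin.Properties as Fin
open import Data.Fin.Subset using (Subset; ∣_∣)
open import Data.List as List using (List; []; _∷_; [_]; _++_; length; take)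
open import Data.List.Membership.Propositional using (_∈_; find)
open import Data.List.Membership.Propositional.Properties
  using (∈-++⁺ˡ; ∈-++⁺ʳ; ∈-++⁻; ∈-∃++; ∈-map⁺; ∈-allFin)
import Data.List.Properties as List
open import Data.List.Relation.Binary.Permutation.Propositional as Perm
  using (_↭_; prep; swap; ↭-sym; ↭-reflexive)
open import Data.List.Relation.Binary.Permutation.Propositional.Properties
  using (shift; ∈-resp-↭; ++-commutativeMonoid; ↭-length)
open import Data.List.Relation.Unary.All as All using (All; []; _∷_)
import Data.List.Relation.Unary.All.Properties as All
open import Data.List.Relation.Unary.AllPairs as AllPairs using (AllPairs; []; _∷_)
open import Data.List.Relation.Unary.Any as Any using (Any; here; there)
open import Data.Nat as ℕ using (ℕ; zero; suc; s≤s; z≤n; _∸_; _≤_)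
open import Data.Nat.Combinatorics using (nC1≡n; nCk+nC[k+1]≡[n+1]C[k+1]) renaming (_C_ to _choose_)
import Data.Nat.Properties as ℕ
open import Data.Product using (_,_; ∃; Σ; _×_; proj₁; proj₂)
import Data.Product.Properties as Product
open import Data.Sum using (_⊎_; inj₁; inj₂)
open import Data.Vec as Vec using (Vec; []; _∷_; lookup)
import Data.Vec.Properties as Vec
open import Function using (_∘_; id; case_of_; _↔_)
open import Function.Bundles using (Equivalence; Inverse; _⇔_)
open import Relation.Binary using (tri<; tri≈; tri>)
open import Relation.Binary.Definitions using (DecidableEquality)
open import Relation.Binary.PropositionalEquality as ≡ using (_≡_; _≢_)
import Relation.Binary.Reasoning.Setoid as SetoidReasoning
open import Relation.Nullary using (¬_; yes; no)
open import Relation.Nullary.Decidable using (¬¬-excluded-middle; decidable-stable)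

-- The obstacle in (1) is that a form of `V_q` may lie in sp(I): its image modulo I is zero, yet its
-- factor enters `sc`. Hence forms of `V_q` receive a leading coefficient and not an image. The
-- offset of a matched form ℓ lies in some sp_j that misses ℓ, so functionals that cut out the
-- largest sp_j first and the smallest last find a nonzero value of ℓ before they can see the
-- offset. The resulting mixed assignment is not a ring homomorphism; it is usable because it
-- extends multiplicatively to lists, respects scaling of single forms and is the identity on sp(S).
-- Its values are nonzero constants and nonzero linear forms, which can be cancelled.
--
-- The doubling in (2) runs backwards because a link enlarges S to S ∪ I. Forms that are pairwise
-- incongruent modulo sp(S ∪ I) stay so modulo sp(S), while a form and its partner are congruent
-- modulo sp(S ∪ I) but, by orthogonality, not modulo sp(S). The constant 4 arises as 2 · 2: D(a,b)
-- has at most 2d entries, and one link is spent on the starting form.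

-- Coefficients of polynomial expressions

allZero′ : ∀ {m} → Vec ℕ m → Bool
allZero′ [] = true
allZero′ (zero ∷ xs) = allZero′ xs
allZero′ (suc _ ∷ _) = false

isUnit′ : ∀ {m} → Fin m → Vec ℕ m → Bool
isUnit′ Fin.zero (1 ∷ xs) = allZero′ xs
isUnit′ Fin.zero (_ ∷ xs) = false
isUnit′ (Fin.suc i) (zero ∷ xs) = isUnit′ i xs
isUnit′ (Fin.suc i) (suc _ ∷ xs) = false

below′ : ∀ {m} → Vec ℕ m → List (Vec ℕ m)
below′ [] = [] ∷ []
below′ (x ∷ xs) = List.concatMap (λ i → List.map (i ∷_) (below′ xs)) (List.upTo (suc x))

module _ {c ℓ} (R : CommutativeRing c ℓ) where
  open CommutativeRing R using (0#; 1#; _+_; _*_) renaming (Carrier to F)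

  -- The helper functions of Defs.coeff are private.  Each is captured here as the solution
  -- of a metavariable; abstracting foldr (or if_then_else_) turns the equation that
  -- determines it into a first-order one.
  mutual
    below° : ∀ n (m : Vec ℕ n) → List (Vec ℕ n)
    below° n m = _

    coeff-⊗ : ∀ n p q m → coeff R n (p ⊗ q) m ≡ List.foldr _+_ 0# (List.map (λ a → coeff R n p a * coeff R n q (Vec.zipWith _∸_ m a)) (below° n m))
    coeff-⊗ n p q m with List.foldr _+_ 0#
    ... | h = ≡.refl

  mutual
    belowTail : ∀ n → Vec ℕ n → List (Vec ℕ n)
    belowTail n xs = _

    below°-∷ : ∀ n x xs → below° (suc n) (x ∷ xs) ≡ List.concatMap (λ i → List.map (i ∷_) (belowTail n xs)) (List.upTo (suc x))
    below°-∷ n x xs = ≡.refl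

  -- Unfolded at dimension suc n, the captured function recurses on vectors of length n with
  -- the module parameter of Defs still suc n; abstracting suc n decouples the two.
  mutual
    belowTail° : ∀ w n → Vec ℕ n → List (Vec ℕ n)
    belowTail° w n xs = _

    belowTail≡ : ∀ n xs → belowTail n xs ≡ below′ xs
    belowTail≡ n xs with suc n
    ... | w = belowTail°≡ w n xs

    belowTail°≡ : ∀ w n (xs : Vec ℕ n) → belowTail° w n xs ≡ below′ xs
    belowTail°≡ w zero [] = ≡.refl
    belowTail°≡ w (suc n) (x ∷ xs) = ≡.cong (λ ys → List.concatMap (λ i → List.map (i ∷_) ys) (List.upTo (suc x))) (belowTail°≡ w n xs)

  mutual
    allZero° : ∀ n (m : Vec ℕ n) → Bool
    allZero° n m = _

    coeff-con : ∀ n a m → coeff R n (con a) m ≡ (if allZero° n m then a else 0#)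
    coeff-con n a m with if_then_else_ {A = F}
    ... | h = ≡.refl

  mutual
    allZeroTail : ∀ n (m : Vec ℕ n) → Bool
    allZeroTail n m = _

    allZero°-∷ : ∀ n xs → allZero° (suc n) (0 ∷ xs) ≡ allZeroTail n xs
    allZero°-∷ n xs = ≡.refl

  mutual
    allZeroTail° : ∀ w n → Vec ℕ n → Bool
    allZeroTail° w n xs = _

    allZeroTail≡ : ∀ n xs → allZeroTail n xs ≡ allZero′ xs
    allZeroTail≡ n xs with suc n
    ... | w = allZeroTail°≡ w n xs

    allZeroTail°≡ : ∀ w n (xs : Vec ℕ n) → allZeroTail° w n xs ≡ allZero′ xs
    allZeroTail°≡ w zero [] = ≡.refl
    allZeroTail°≡ w (suc n) (zero ∷ xs) = allZeroTail°≡ w n xs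
    allZeroTail°≡ w (suc n) (suc _ ∷ xs) = ≡.refl

  allZero°≡ : ∀ n xs → allZero° n xs ≡ allZero′ xs
  allZero°≡ zero [] = ≡.refl
  allZero°≡ (suc n) (zero ∷ xs) = allZeroTail≡ n xs
  allZero°≡ (suc n) (suc x ∷ xs) = ≡.refl

  mutual
    isUnit° : ∀ n → Fin n → (m : Vec ℕ n) → Bool
    isUnit° n i m = _

    coeff-var : ∀ n i m → coeff R n (var i) m ≡ (if isUnit° n i m then 1# else 0#)
    coeff-var n i m with if_then_else_ {A = F}
    ... | h = ≡.refl

  mutual
    isUnitTail : ∀ n → Fin n → Vec ℕ n → Bool
    isUnitTail n i m = _

    isUnit°-∷ : ∀ n i xs → isUnit° (suc n) (Fin.suc i) (0 ∷ xs) ≡ isUnitTail n i xs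
    isUnit°-∷ n i xs = ≡.refl

  mutual
    isUnitTail° : ∀ w n → Fin n → Vec ℕ n → Bool
    isUnitTail° w n i xs = _

    isUnitTail≡ : ∀ n i xs → isUnitTail n i xs ≡ isUnit′ i xs
    isUnitTail≡ n i xs with suc n
    ... | w = isUnitTail°≡ w n i xs

    isUnitTail°≡ : ∀ w n i (xs : Vec ℕ n) → isUnitTail° w n i xs ≡ isUnit′ i xs
    isUnitTail°≡ w (suc n) Fin.zero (0 ∷ xs) = ≡.refl
    isUnitTail°≡ w (suc n) Fin.zero (1 ∷ xs) = allZeroTail°≡ w n xs
    isUnitTail°≡ w (suc n) Fin.zero (suc (suc _) ∷ xs) = ≡.refl
    isUnitTail°≡ w (suc n) (Fin.suc i) (zero ∷ xs) = isUnitTail°≡ w n i xs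
    isUnitTail°≡ w (suc n) (Fin.suc i) (suc _ ∷ xs) = ≡.refl

  isUnit°≡ : ∀ n i xs → isUnit° n i xs ≡ isUnit′ i xs
  isUnit°≡ (suc n) Fin.zero (0 ∷ xs) = ≡.refl
  isUnit°≡ (suc n) Fin.zero (1 ∷ xs) = allZeroTail≡ n xs
  isUnit°≡ (suc n) Fin.zero (suc (suc _) ∷ xs) = ≡.refl
  isUnit°≡ (suc n) (Fin.suc i) (zero ∷ xs) = isUnitTail≡ n i xs
  isUnit°≡ (suc n) (Fin.suc i) (suc _ ∷ xs) = ≡.refl

  below°≡ : ∀ n m → below° n m ≡ below′ m
  below°≡ zero [] = ≡.refl
  below°≡ (suc n) (x ∷ xs) = ≡.cong (λ ys → List.concatMap (λ i → List.map (i ∷_) ys) (List.upTo (suc x))) (belowTail≡ n xs)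

  mutual
    -- A sum over a one-element index set unfolds to a single `pick` plus zero, which determines
    -- this metavariable.
    pick° : (n : ℕ) → (b : Bool) → (b ≡ true → Poly R n) → Poly R n
    pick° n b f = _

    sumIn-∷ : ∀ n b f → sumIn R n (b ∷ []) (λ { Fin.zero → f }) ≡ (pick° n b f ⊕ con 0#)
    sumIn-∷ n b f = ≡.refl

-- Univariate polynomials over a commutative ring

record Hom {a ℓ₁ b ℓ₂} (A : CommutativeRing a ℓ₁) (B : CommutativeRing b ℓ₂) : Set (a ⊔ ℓ₁ ⊔ b ⊔ ℓ₂) where
  private
    module A = CommutativeRing A
    module B = CommutativeRing B
  field
    fn     : A.Carrier → B.Carrier
    cong   : ∀ {x y} → x A.≈ y → fn x B.≈ fn y
    +-homo : ∀ x y → fn (x A.+ y) B.≈ fn x B.+ fn y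
    *-homo : ∀ x y → fn (x A.* y) B.≈ fn x B.* fn y
    0-homo : fn A.0# B.≈ B.0#
    1-homo : fn A.1# B.≈ B.1#

module Identities {c ℓ} (A : CommutativeRing c ℓ) where
  open CommutativeRing A
  open NaturalCoefficients commutativeSemiring

  +-*-interchange : ∀ a b x p q → (a + b) * x + (p + q) ≈ (a * x + p) + (b * x + q)
  +-*-interchange = solve 5 (λ a b x p q → (a :+ b) :* x :+ (p :+ q) := (a :* x :+ p) :+ (b :* x :+ q)) refl

  *-collect : ∀ a b x p q → a * b * x + (a * p + q) ≈ a * (b * x + p) + q
  *-collect = solve 5 (λ a b x p q → a :* b :* x :+ (a :* p :+ q) := a :* (b :* x :+ p) :+ q) refl

  horner-+ : ∀ p q y u v → (p + q) + y * (u + v) ≈ (p + y * u) + (q + y * v)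
  horner-+ = solve 5 (λ p q y u v → (p :+ q) :+ y :* (u :+ v) := (p :+ y :* u) :+ (q :+ y :* v)) refl

  horner-scale : ∀ p q y u → p * q + y * (p * u) ≈ p * (q + y * u)
  horner-scale = solve 4 (λ p q y u → p :* q :+ y :* (p :* u) := p :* (q :+ y :* u)) refl

  horner-* : ∀ p y u v → p * v + y * (u * v) ≈ (p + y * u) * v
  horner-* = solve 4 (λ p y u v → p :* v :+ y :* (u :* v) := (p :+ y :* u) :* v) refl

module Univariate {c ℓ} (A : CommutativeRing c ℓ) where
  open CommutativeRing A
  open SetoidReasoning setoid
  open RingProperties ring using (-0#≈0#)
  open Identities A

  -- The Cauchy product, on coefficient functions so that list lengths do not matter, and by peeling
  -- off the lowest coefficient so that the ring laws become inductions on the degree.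
  conv : (ℕ → Carrier) → (ℕ → Carrier) → ℕ → Carrier
  conv u v zero    = u 0 * v 0
  conv u v (suc k) = u 0 * v (suc k) + conv (u ∘ suc) v k

  conv-cong : ∀ {u u′ v v′} → (∀ k → u k ≈ u′ k) → (∀ k → v k ≈ v′ k) → ∀ k → conv u v k ≈ conv u′ v′ k
  conv-cong p q zero    = *-cong (p 0) (q 0)
  conv-cong p q (suc k) = +-cong (*-cong (p 0) (q (suc k))) (conv-cong (p ∘ suc) q k)

  conv-zeroˡ : ∀ v k → conv (λ _ → 0#) v k ≈ 0#
  conv-zeroˡ v zero    = zeroˡ _
  conv-zeroˡ v (suc k) = trans (+-cong (zeroˡ _) (conv-zeroˡ v k)) (+-identityˡ 0#)

  conv-distribʳ : ∀ v u u′ k → conv (λ j → u j + u′ j) v k ≈ conv u v k + conv u′ v k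
  conv-distribʳ v u u′ zero    = distribʳ _ _ _
  conv-distribʳ v u u′ (suc k) = begin
    (u 0 + u′ 0) * v (suc k) + conv (λ j → u (suc j) + u′ (suc j)) v k
      ≈⟨ +-congˡ (conv-distribʳ v (u ∘ suc) (u′ ∘ suc) k) ⟩
    (u 0 + u′ 0) * v (suc k) + (conv (u ∘ suc) v k + conv (u′ ∘ suc) v k)
      ≈⟨ +-*-interchange (u 0) (u′ 0) (v (suc k)) _ _ ⟩
    conv u v (suc k) + conv u′ v (suc k) ∎

  conv-scaleˡ : ∀ a u v k → conv (λ j → a * u j) v k ≈ a * conv u v k
  conv-scaleˡ a u v zero    = *-assoc _ _ _
  conv-scaleˡ a u v (suc k) = begin
    a * u 0 * v (suc k) + conv (λ j → a * u (suc j)) v k ≈⟨ +-cong (*-assoc _ _ _) (conv-scaleˡ a (u ∘ suc) v k) ⟩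
    a * (u 0 * v (suc k)) + a * conv (u ∘ suc) v k       ≈⟨ distribˡ _ _ _ ⟨
    a * conv u v (suc k)                                 ∎

  -- Peeling at the other end; played against the defining recursion it gives commutativity.
  conv-sucʳ : ∀ u v k → conv u v (suc k) ≈ conv u (v ∘ suc) k + u (suc k) * v 0
  conv-sucʳ u v zero    = refl
  conv-sucʳ u v (suc k) = trans (+-congˡ (conv-sucʳ (u ∘ suc) v k)) (sym (+-assoc _ _ _))

  conv-comm : ∀ u v k → conv u v k ≈ conv v u k
  conv-comm u v zero    = *-comm _ _
  conv-comm u v (suc k) = begin
    u 0 * v (suc k) + conv (u ∘ suc) v k ≈⟨ +-cong (*-comm _ _) (conv-comm (u ∘ suc) v k) ⟩
    v (suc k) * u 0 + conv v (u ∘ suc) k ≈⟨ +-comm _ _ ⟩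
    conv v (u ∘ suc) k + v (suc k) * u 0 ≈⟨ conv-sucʳ v u k ⟨
    conv v u (suc k)                     ∎

  conv-assoc : ∀ u v w k → conv (conv u v) w k ≈ conv u (conv v w) k
  conv-assoc u v w zero    = *-assoc _ _ _
  conv-assoc u v w (suc k) = begin
    u 0 * v 0 * w (suc k) + conv (λ j → u 0 * v (suc j) + conv (u ∘ suc) v j) w k
      ≈⟨ +-congˡ (conv-distribʳ w (λ j → u 0 * v (suc j)) (conv (u ∘ suc) v) k) ⟩
    u 0 * v 0 * w (suc k) + (conv (λ j → u 0 * v (suc j)) w k + conv (conv (u ∘ suc) v) w k)
      ≈⟨ +-congˡ (+-cong (conv-scaleˡ (u 0) (v ∘ suc) w k) (conv-assoc (u ∘ suc) v w k)) ⟩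
    u 0 * v 0 * w (suc k) + (u 0 * conv (v ∘ suc) w k + conv (u ∘ suc) (conv v w) k)
      ≈⟨ *-collect (u 0) (v 0) (w (suc k)) _ _ ⟩
    conv u (conv v w) (suc k) ∎

  coef : List Carrier → ℕ → Carrier
  coef []      k       = 0#
  coef (a ∷ f) zero    = a
  coef (a ∷ f) (suc k) = coef f k

  infix 4 _≋_
  -- Coefficientwise, since trailing zeros can be neither detected nor stripped. A record, so that
  -- both lists can be inferred from the type.
  record _≋_ (f g : List Carrier) : Set ℓ where
    constructor coefwise
    field at : ∀ k → coef f k ≈ coef g k
  open _≋_ public

  infixl 6 _+ₗ_
  infixl 7 _*ₗ_

  _+ₗ_ _*ₗ_ : List Carrier → List Carrier → List Carrier
  []      +ₗ g       = g
  (a ∷ f) +ₗ []      = a ∷ f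
  (a ∷ f) +ₗ (b ∷ g) = (a + b) ∷ (f +ₗ g)

  scale : Carrier → List Carrier → List Carrier
  scale a = List.map (a *_)

  []      *ₗ g = []
  (a ∷ f) *ₗ g = scale a g +ₗ (0# ∷ (f *ₗ g))

  -ₗ_ : List Carrier → List Carrier
  -ₗ_ = List.map (-_)

  coef-+ : ∀ f g k → coef (f +ₗ g) k ≈ coef f k + coef g k
  coef-+ []      g       k       = sym (+-identityˡ _)
  coef-+ (a ∷ f) []      k       = sym (+-identityʳ _)
  coef-+ (a ∷ f) (b ∷ g) zero    = refl
  coef-+ (a ∷ f) (b ∷ g) (suc k) = coef-+ f g k

  coef-scale : ∀ a f k → coef (scale a f) k ≈ a * coef f k
  coef-scale a []      k       = sym (zeroʳ a)
  coef-scale a (b ∷ f) zero    = refl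
  coef-scale a (b ∷ f) (suc k) = coef-scale a f k

  coef-neg : ∀ f k → coef (-ₗ f) k ≈ - coef f k
  coef-neg []      k       = sym -0#≈0#
  coef-neg (a ∷ f) zero    = refl
  coef-neg (a ∷ f) (suc k) = coef-neg f k

  coef-* : ∀ f g k → coef (f *ₗ g) k ≈ conv (coef f) (coef g) k
  coef-* []      g k       = sym (conv-zeroˡ (coef g) k)
  coef-* (a ∷ f) g zero    = trans (coef-+ (scale a g) _ 0) (trans (+-identityʳ _) (coef-scale a g 0))
  coef-* (a ∷ f) g (suc k) = trans (coef-+ (scale a g) _ (suc k)) (+-cong (coef-scale a g (suc k)) (coef-* f g k))

  coef-1 : ∀ v k → conv (coef (1# ∷ [])) v k ≈ v k
  coef-1 v zero    = *-identityˡ _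
  coef-1 v (suc k) = trans (+-cong (*-identityˡ _) (conv-zeroˡ v k)) (+-identityʳ _)

  polyRing : CommutativeRing c ℓ
  polyRing = record
    { Carrier = List Carrier ; _≈_ = _≋_ ; _+_ = _+ₗ_ ; _*_ = _*ₗ_ ; -_ = -ₗ_ ; 0# = [] ; 1# = 1# ∷ []
    ; isCommutativeRing = record
      { isRing = record
        { +-isAbelianGroup = record
          { isGroup = record
            { isMonoid = record
              { isSemigroup = record
                { isMagma = record
                  { isEquivalence = record
                    { refl  = coefwise λ k → refl
                    ; sym   = λ p → coefwise λ k → sym (at p k)
                    ; trans = λ p q → coefwise λ k → trans (at p k) (at q k) }
                  ; ∙-cong = λ {f} {f′} {g} {g′} p q → coefwise λ k →
                      trans (coef-+ f g k) (trans (+-cong (at p k) (at q k)) (sym (coef-+ f′ g′ k))) }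
                ; assoc = λ f g h → coefwise λ k → trans (coef-+ (f +ₗ g) h k) (trans (+-congʳ (coef-+ f g k))
                    (trans (+-assoc _ _ _) (trans (+-congˡ (sym (coef-+ g h k))) (sym (coef-+ f (g +ₗ h) k))))) }
              ; identity = (λ f → coefwise λ k → refl) ,
                  (λ f → coefwise λ k → trans (coef-+ f [] k) (+-identityʳ _)) }
            ; inverse = (λ f → coefwise λ k → trans (coef-+ (-ₗ f) f k) (trans (+-congʳ (coef-neg f k)) (-‿inverseˡ _))) ,
                (λ f → coefwise λ k → trans (coef-+ f (-ₗ f) k) (trans (+-congˡ (coef-neg f k)) (-‿inverseʳ _)))
            ; ⁻¹-cong = λ {f} {g} p → coefwise λ k → trans (coef-neg f k) (trans (-‿cong (at p k)) (sym (coef-neg g k))) }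
          ; comm = λ f g → coefwise λ k → trans (coef-+ f g k) (trans (+-comm _ _) (sym (coef-+ g f k))) }
        ; *-cong = λ {f} {f′} {g} {g′} p q → coefwise λ k →
            trans (coef-* f g k) (trans (conv-cong (at p) (at q) k) (sym (coef-* f′ g′ k)))
        ; *-assoc = λ f g h → coefwise λ k → trans (coef-* (f *ₗ g) h k)
            (trans (conv-cong (coef-* f g) (λ _ → refl) k) (trans (conv-assoc (coef f) (coef g) (coef h) k)
              (trans (conv-cong (λ _ → refl) (λ j → sym (coef-* g h j)) k) (sym (coef-* f (g *ₗ h) k)))))
        ; *-identity = (λ f → coefwise (oneˡ f)) , (λ f → coefwise λ k → trans (mul-comm f _ k) (oneˡ f k))
        ; distrib = (λ f g h → coefwise λ k → trans (mul-comm f (g +ₗ h) k) (trans (dist f g h k)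
              (trans (+-cong (mul-comm g f k) (mul-comm h f k)) (sym (coef-+ (f *ₗ g) (f *ₗ h) k))))) ,
            (λ f g h → coefwise λ k → trans (dist f g h k) (sym (coef-+ (g *ₗ f) (h *ₗ f) k))) }
      ; *-comm = λ f g → coefwise (mul-comm f g) } }
    where
    mul-comm : ∀ f g k → coef (f *ₗ g) k ≈ coef (g *ₗ f) k
    mul-comm f g k = trans (coef-* f g k) (trans (conv-comm (coef f) (coef g) k) (sym (coef-* g f k)))

    oneˡ : ∀ f k → coef ((1# ∷ []) *ₗ f) k ≈ coef f k
    oneˡ f k = trans (coef-* (1# ∷ []) f k) (coef-1 (coef f) k)

    dist : ∀ f g h k → coef ((g +ₗ h) *ₗ f) k ≈ coef (g *ₗ f) k + coef (h *ₗ f) k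
    dist f g h k = trans (coef-* (g +ₗ h) f k) (trans (conv-cong (coef-+ g h) (λ _ → refl) k)
      (trans (conv-distribʳ (coef f) (coef g) (coef h) k) (+-cong (sym (coef-* g f k)) (sym (coef-* h f k)))))

  [_]-cong : ∀ {a b} → a ≈ b → (a ∷ []) ≋ (b ∷ [])
  [_]-cong p = coefwise λ { zero → p ; (suc k) → refl }

  constant : Hom A polyRing
  constant = record
    { fn = λ a → a ∷ [] ; cong = [_]-cong
    ; +-homo = λ _ _ → coefwise λ _ → refl
    ; *-homo = λ a b → coefwise λ { zero → sym (+-identityʳ _) ; (suc k) → refl }
    ; 0-homo = coefwise λ { zero → refl ; (suc k) → refl }
    ; 1-homo = coefwise λ _ → refl }

module Evaluation {a ℓ₁ b ℓ₂} {A : CommutativeRing a ℓ₁} {B : CommutativeRing b ℓ₂} (h : Hom A B) (x : CommutativeRing.Carrier B) where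
  private
    module A = CommutativeRing A
  open CommutativeRing B
  open SetoidReasoning setoid
  open Univariate A
  open Identities B
  open Hom h

  eval : List A.Carrier → Carrier
  eval []      = 0#
  eval (c ∷ f) = fn c + x * eval f

  -- Covers the trailing zeros by which two equal polynomials may differ in length.
  eval-zero : ∀ f → (∀ k → coef f k A.≈ A.0#) → eval f ≈ 0#
  eval-zero []      p = refl
  eval-zero (c ∷ f) p = begin
    fn c + x * eval f ≈⟨ +-cong (trans (cong (p 0)) 0-homo) (*-congˡ (eval-zero f (λ k → p (suc k)))) ⟩
    0# + x * 0#       ≈⟨ trans (+-identityˡ _) (zeroʳ x) ⟩
    0#                ∎

  eval-cong : ∀ f g → (∀ k → coef f k A.≈ coef g k) → eval f ≈ eval g
  eval-cong []      g       p = sym (eval-zero g (λ k → A.sym (p k)))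
  eval-cong (c ∷ f) []      p = eval-zero (c ∷ f) p
  eval-cong (c ∷ f) (d ∷ g) p = +-cong (cong (p 0)) (*-congˡ (eval-cong f g (λ k → p (suc k))))

  eval-+ : ∀ f g → eval (f +ₗ g) ≈ eval f + eval g
  eval-+ []      g       = sym (+-identityˡ _)
  eval-+ (c ∷ f) []      = sym (+-identityʳ _)
  eval-+ (c ∷ f) (d ∷ g) = begin
    fn (c A.+ d) + x * eval (f +ₗ g)          ≈⟨ +-cong (+-homo c d) (*-congˡ (eval-+ f g)) ⟩
    (fn c + fn d) + x * (eval f + eval g)     ≈⟨ horner-+ (fn c) (fn d) x _ _ ⟩
    (fn c + x * eval f) + (fn d + x * eval g) ∎

  eval-scale : ∀ c f → eval (scale c f) ≈ fn c * eval f
  eval-scale c []      = sym (zeroʳ _)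
  eval-scale c (d ∷ f) = begin
    fn (c A.* d) + x * eval (scale c f)   ≈⟨ +-cong (*-homo c d) (*-congˡ (eval-scale c f)) ⟩
    fn c * fn d + x * (fn c * eval f)     ≈⟨ horner-scale (fn c) (fn d) x _ ⟩
    fn c * (fn d + x * eval f)            ∎

  eval-* : ∀ f g → eval (f *ₗ g) ≈ eval f * eval g
  eval-* []      g = sym (zeroˡ _)
  eval-* (c ∷ f) g = begin
    eval (scale c g +ₗ (A.0# ∷ (f *ₗ g)))             ≈⟨ eval-+ (scale c g) _ ⟩
    eval (scale c g) + (fn A.0# + x * eval (f *ₗ g))  ≈⟨ +-cong (eval-scale c g) (trans (+-congʳ 0-homo) (+-identityˡ _)) ⟩
    fn c * eval g + x * eval (f *ₗ g)                 ≈⟨ +-congˡ (*-congˡ (eval-* f g)) ⟩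
    fn c * eval g + x * (eval f * eval g)             ≈⟨ horner-* (fn c) x _ _ ⟩
    (fn c + x * eval f) * eval g                      ∎

  eval-const : ∀ c → eval (c ∷ []) ≈ fn c
  eval-const c = trans (+-congˡ (zeroʳ x)) (+-identityʳ _)

  evaluation : Hom polyRing B
  evaluation = record
    { fn = eval ; cong = λ {f} {g} p → eval-cong f g (at p) ; +-homo = eval-+ ; *-homo = eval-*
    ; 0-homo = refl ; 1-homo = trans (eval-const A.1#) 1-homo }

-- Finite sums and ring homomorphisms

module Sums {c ℓ} (A : CommutativeRing c ℓ) where
  open CommutativeRing A
  open SetoidReasoning setoid
  open NaturalCoefficients commutativeSemiring using (solve; _:+_; _:=_)

  ∑ : ∀ {b} {B : Set b} → List B → (B → Carrier) → Carrier
  ∑ xs f = List.foldr _+_ 0# (List.map f xs)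

  ∑-cong : ∀ {b} {B : Set b} (xs : List B) {f g : B → Carrier} → (∀ x → f x ≈ g x) → ∑ xs f ≈ ∑ xs g
  ∑-cong []       p = refl
  ∑-cong (x ∷ xs) p = +-cong (p x) (∑-cong xs p)

  ∑-++ : ∀ {b} {B : Set b} (xs ys : List B) (f : B → Carrier) → ∑ (xs ++ ys) f ≈ ∑ xs f + ∑ ys f
  ∑-++ []       ys f = sym (+-identityˡ _)
  ∑-++ (x ∷ xs) ys f = trans (+-congˡ (∑-++ xs ys f)) (sym (+-assoc _ _ _))

  ∑-map : ∀ {b d} {B : Set b} {D : Set d} (xs : List B) (g : B → D) (f : D → Carrier) →
          ∑ (List.map g xs) f ≈ ∑ xs (f ∘ g)
  ∑-map []       g f = refl
  ∑-map (x ∷ xs) g f = +-congˡ (∑-map xs g f)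

  ∑-concatMap : ∀ {b d} {B : Set b} {D : Set d} (xs : List B) (g : B → List D) (f : D → Carrier) →
                ∑ (List.concatMap g xs) f ≈ ∑ xs (λ x → ∑ (g x) f)
  ∑-concatMap []       g f = refl
  ∑-concatMap (x ∷ xs) g f = trans (∑-++ (g x) _ f) (+-congˡ (∑-concatMap xs g f))

  *-distribˡ-∑ : ∀ {b} {B : Set b} (xs : List B) a (f : B → Carrier) → a * ∑ xs f ≈ ∑ xs (λ x → a * f x)
  *-distribˡ-∑ []       a f = zeroʳ a
  *-distribˡ-∑ (x ∷ xs) a f = trans (distribˡ _ _ _) (+-congˡ (*-distribˡ-∑ xs a f))

module HomSum {a ℓ₁ b ℓ₂} {A : CommutativeRing a ℓ₁} {B : CommutativeRing b ℓ₂} (h : Hom A B) where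
  open Hom h
  module SA = Sums A
  module SB = Sums B
  open CommutativeRing B

  ∑-homo : ∀ {d} {D : Set d} (xs : List D) (f : D → CommutativeRing.Carrier A) → fn (SA.∑ xs f) ≈ SB.∑ xs (fn ∘ f)
  ∑-homo []       f = 0-homo
  ∑-homo (x ∷ xs) f = trans (+-homo _ _) (+-congˡ (∑-homo xs f))

_∘ₕ_ : ∀ {a ℓ₁ b ℓ₂ d ℓ₃} {A : CommutativeRing a ℓ₁} {B : CommutativeRing b ℓ₂} {D : CommutativeRing d ℓ₃} →
       Hom B D → Hom A B → Hom A D
_∘ₕ_ {D = D} g f = record
  { fn = G.fn ∘ F.fn ; cong = G.cong ∘ F.cong
  ; +-homo = λ x y → trans (G.cong (F.+-homo x y)) (G.+-homo _ _)
  ; *-homo = λ x y → trans (G.cong (F.*-homo x y)) (G.*-homo _ _)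
  ; 0-homo = trans (G.cong F.0-homo) G.0-homo
  ; 1-homo = trans (G.cong F.1-homo) G.1-homo }
  where
  module F = Hom f
  module G = Hom g
  open CommutativeRing D using (trans)

idₕ : ∀ {a ℓ} (A : CommutativeRing a ℓ) → Hom A A
idₕ A = record { fn = id ; cong = id ; +-homo = λ _ _ → refl ; *-homo = λ _ _ → refl ; 0-homo = refl ; 1-homo = refl }
  where open CommutativeRing A using (refl)

-- Non-zero-divisors

-- Stated for single elements, so that it can be assembled from the factors of a product without
-- testing polynomials for zero.
Regular : ∀ {c ℓ} (A : CommutativeRing c ℓ) → CommutativeRing.Carrier A → Set (c ⊔ ℓ)
Regular A r = ∀ g → r * g ≈ 0# → g ≈ 0#
  where open CommutativeRing A

module Regularity {c ℓ} (A : CommutativeRing c ℓ) where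
  open CommutativeRing A
  open SetoidReasoning setoid
  open Univariate A

  unit-regular : ∀ {r u} → u * r ≈ 1# → Regular A r
  unit-regular {r} {u} ur≈1 g rg≈0 = begin
    g           ≈⟨ *-identityˡ g ⟨
    1# * g      ≈⟨ *-congʳ ur≈1 ⟨
    u * r * g   ≈⟨ *-assoc _ _ _ ⟩
    u * (r * g) ≈⟨ *-congˡ rg≈0 ⟩
    u * 0#      ≈⟨ zeroʳ u ⟩
    0#          ∎

  *-regular : ∀ {r s} → Regular A r → Regular A s → Regular A (r * s)
  *-regular R S g rsg≈0 = S g (R _ (trans (sym (*-assoc _ _ _)) rsg≈0))

  regular-cong : ∀ {r s} → r ≈ s → Regular A r → Regular A s
  regular-cong r≈s R g sg≈0 = R g (trans (*-congʳ r≈s) sg≈0)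

  private
    linear-coef : ∀ a b f k → coef ((a ∷ b ∷ []) *ₗ f) (suc k) ≈ a * coef f (suc k) + b * coef f k
    linear-coef a b f k = trans (coef-* (a ∷ b ∷ []) f (suc k)) (+-congˡ (single k))
      where
      single : ∀ k → conv (coef (b ∷ [])) (coef f) k ≈ b * coef f k
      single zero    = refl
      single (suc k) = trans (+-congˡ (conv-zeroˡ (coef f) k)) (+-identityʳ _)

  -- A regular constant term determines the coefficients of the cofactor from degree 0 upwards.
  linear-regular-low : ∀ {a b} → Regular A a → Regular polyRing (a ∷ b ∷ [])
  linear-regular-low {a} {b} R f p = coefwise go
    where
    go : ∀ k → coef f k ≈ 0#
    go zero    = R _ (trans (sym (coef-* (a ∷ b ∷ []) f 0)) (at p 0))
    go (suc k) = R _ (begin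
      a * coef f (suc k)                 ≈⟨ +-identityʳ _ ⟨
      a * coef f (suc k) + 0#            ≈⟨ +-congˡ (trans (*-congˡ (go k)) (zeroʳ b)) ⟨
      a * coef f (suc k) + b * coef f k  ≈⟨ linear-coef a b f k ⟨
      coef ((a ∷ b ∷ []) *ₗ f) (suc k)   ≈⟨ at p (suc k) ⟩
      0#                                 ∎)

  -- A regular leading coefficient determines the coefficients of the cofactor from the top down,
  -- hence the recursion on the list.
  linear-regular-high : ∀ {a b} → Regular A b → Regular polyRing (a ∷ b ∷ [])
  linear-regular-high {a} {b} R f p = coefwise (go f (λ k → trans (sym (linear-coef a b f k)) (at p (suc k))))
    where
    go : ∀ f → (∀ k → a * coef f (suc k) + b * coef f k ≈ 0#) → ∀ k → coef f k ≈ 0#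
    go []      q k       = refl
    go (x ∷ f) q (suc k) = go f (q ∘ suc) k
    go (x ∷ f) q zero    = R _ (begin
      b * x                  ≈⟨ +-identityˡ _ ⟨
      0# + b * x             ≈⟨ +-congʳ (trans (*-congˡ (go f (q ∘ suc) 0)) (zeroʳ a)) ⟨
      a * coef f 0 + b * x   ≈⟨ q 0 ⟩
      0#                     ∎)

-- Polynomials in n variables as an iterated polynomial ring

module Multivariate {c ℓ} (R : CommutativeRing c ℓ) where
  open CommutativeRing R using () renaming (Carrier to F)
  private module F = CommutativeRing R

  -- The first variable is the outermost one, so a coefficient is read off by walking along the
  -- exponent vector.
  𝕋 : ℕ → CommutativeRing c ℓ
  𝕋 zero    = R
  𝕋 (suc n) = Univariate.polyRing (𝕋 n)

  ∣𝕋_∣ : ℕ → Set c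
  ∣𝕋 n ∣ = CommutativeRing.Carrier (𝕋 n)

  cst : ∀ n → Hom R (𝕋 n)
  cst zero    = idₕ R
  cst (suc n) = Univariate.constant (𝕋 n) ∘ₕ cst n

  X : ∀ {n} → Fin n → ∣𝕋 n ∣
  X {suc n} Fin.zero    = let open CommutativeRing (𝕋 n) in 0# ∷ 1# ∷ []
  X {suc n} (Fin.suc i) = X i ∷ []

  norm : ∀ n → Poly R n → ∣𝕋 n ∣
  norm n (con a) = Hom.fn (cst n) a
  norm n (var i) = X i
  norm n (p ⊕ q) = let open CommutativeRing (𝕋 n) in norm n p + norm n q
  norm n (p ⊗ q) = let open CommutativeRing (𝕋 n) in norm n p * norm n q

  coefT : ∀ n → ∣𝕋 n ∣ → Vec ℕ n → F
  coefT zero    a []      = a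
  coefT (suc n) f (k ∷ m) = coefT n (Univariate.coef (𝕋 n) f k) m

  Eq : ∀ n → ∣𝕋 n ∣ → ∣𝕋 n ∣ → Set ℓ
  Eq n = CommutativeRing._≈_ (𝕋 n)

  syntax Eq n f g = f ≈[ n ] g

  coefT-cong : ∀ n {f g} → f ≈[ n ] g → ∀ m → coefT n f m F.≈ coefT n g m
  coefT-cong zero    p []      = p
  coefT-cong (suc n) p (k ∷ m) = coefT-cong n (Univariate._≋_.at p k) m

  coefT-injective : ∀ n {f g} → (∀ m → coefT n f m F.≈ coefT n g m) → f ≈[ n ] g
  coefT-injective zero    p = p []
  coefT-injective (suc n) p = Univariate.coefwise λ k → coefT-injective n (λ m → p (k ∷ m))

  coefT-+ : ∀ n f g m → coefT n (CommutativeRing._+_ (𝕋 n) f g) m F.≈ coefT n f m F.+ coefT n g m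
  coefT-+ zero    f g []      = F.refl
  coefT-+ (suc n) f g (k ∷ m) =
    F.trans (coefT-cong n (Univariate.coef-+ (𝕋 n) f g k) m) (coefT-+ n _ _ m)

  coefT-0 : ∀ n m → coefT n (CommutativeRing.0# (𝕋 n)) m F.≈ F.0#
  coefT-0 zero    []      = F.refl
  coefT-0 (suc n) (k ∷ m) = coefT-0 n m

  coefT-∑ : ∀ n {b} {B : Set b} (xs : List B) f m → coefT n (Sums.∑ (𝕋 n) xs f) m F.≈ Sums.∑ R xs (λ x → coefT n (f x) m)
  coefT-∑ n []       f m = coefT-0 n m
  coefT-∑ n (x ∷ xs) f m = F.trans (coefT-+ n _ _ m) (F.+-congˡ (coefT-∑ n xs f m))

  open Sums R using (∑; ∑-cong; ∑-map; ∑-concatMap)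

  conv-∑ : ∀ {a ℓ′} (A : CommutativeRing a ℓ′) u v k →
    let open CommutativeRing A in Univariate.conv A u v k ≈ Sums.∑ A (List.upTo (suc k)) (λ i → u i * v (k ∸ i))
  conv-∑ A u v k = subst′ (go u v k)
    where
    open CommutativeRing A
    go : ∀ u v k → Univariate.conv A u v k ≈ List.foldr _+_ 0# (List.applyUpTo (λ i → u i * v (k ∸ i)) (suc k))
    go u v zero    = sym (+-identityʳ _)
    go u v (suc k) = +-congˡ (go (u ∘ suc) v k)
    subst′ = ≡.subst (λ l → Univariate.conv A u v k ≈ List.foldr _+_ 0# l)
      (≡.sym (List.map-upTo (λ i → u i * v (k ∸ i)) (suc k)))

  coefT-* : ∀ n f g m → coefT n (CommutativeRing._*_ (𝕋 n) f g) m F.≈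
            ∑ (below′ m) (λ a → coefT n f a F.* coefT n g (Vec.zipWith _∸_ m a))
  coefT-* zero    f g []      = F.sym (F.+-identityʳ _)
  coefT-* (suc n) f g (k ∷ m) = begin
    coefT n (coef (f *ₗ g) k) m
      ≈⟨ coefT-cong n (Tₙ.trans (coef-* f g k) (conv-∑ (𝕋 n) (coef f) (coef g) k)) m ⟩
    coefT n (Sums.∑ (𝕋 n) (List.upTo (suc k)) (λ i → coef f i Tₙ.* coef g (k ∸ i))) m
      ≈⟨ coefT-∑ n (List.upTo (suc k)) _ m ⟩
    ∑ (List.upTo (suc k)) (λ i → coefT n (coef f i Tₙ.* coef g (k ∸ i)) m)
      ≈⟨ ∑-cong (List.upTo (suc k)) (λ i → F.trans (coefT-* n (coef f i) (coef g (k ∸ i)) m) (F.sym (∑-map (below′ m) (i ∷_) term))) ⟩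
    ∑ (List.upTo (suc k)) (λ i → ∑ (List.map (i ∷_) (below′ m)) term)
      ≈⟨ ∑-concatMap (List.upTo (suc k)) (λ i → List.map (i ∷_) (below′ m)) term ⟨
    ∑ (below′ (k ∷ m)) term ∎
    where
    module Tₙ = CommutativeRing (𝕋 n)
    open Univariate (𝕋 n)
    open SetoidReasoning F.setoid
    term : Vec ℕ (suc n) → F
    term a = coefT (suc n) f a F.* coefT (suc n) g (Vec.zipWith _∸_ (k ∷ m) a)

  coefT-cst : ∀ n a m → coefT n (Hom.fn (cst n) a) m F.≈ (if allZero′ m then a else F.0#)
  coefT-cst zero    a []          = F.refl
  coefT-cst (suc n) a (zero ∷ m)  = coefT-cst n a m
  coefT-cst (suc n) a (suc _ ∷ m) = coefT-0 n m

  coefT-X : ∀ n i m → coefT n (X i) m F.≈ (if isUnit′ i m then F.1# else F.0#)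
  coefT-X (suc n) Fin.zero    (0 ∷ m)           = coefT-0 n m
  coefT-X (suc n) Fin.zero    (1 ∷ m)           =
    F.trans (coefT-cong n (CommutativeRing.sym (𝕋 n) (Hom.1-homo (cst n))) m) (coefT-cst n F.1# m)
  coefT-X (suc n) Fin.zero    (suc (suc _) ∷ m) = coefT-0 n m
  coefT-X (suc n) (Fin.suc i) (0 ∷ m)           = coefT-X n i m
  coefT-X (suc n) (Fin.suc i) (suc _ ∷ m)       = coefT-0 n m

  -- The bridge from expressions compared by coefficients to a ring in which one can compute and
  -- cancel.
  coeff-norm : ∀ n p m → coeff R n p m F.≈ coefT n (norm n p) m
  coeff-norm n (con a) m = F.trans
    (F.reflexive (≡.trans (coeff-con R n a m) (≡.cong (λ b → if b then a else F.0#) (allZero°≡ R n m))))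
    (F.sym (coefT-cst n a m))
  coeff-norm n (var i) m = F.trans
    (F.reflexive (≡.trans (coeff-var R n i m) (≡.cong (λ b → if b then F.1# else F.0#) (isUnit°≡ R n i m))))
    (F.sym (coefT-X n i m))
  coeff-norm n (p ⊕ q) m = F.trans (F.+-cong (coeff-norm n p m) (coeff-norm n q m)) (F.sym (coefT-+ n _ _ m))
  coeff-norm n (p ⊗ q) m = begin
    coeff R n (p ⊗ q) m
      ≡⟨ ≡.trans (coeff-⊗ R n p q m) (≡.cong (λ B → ∑ B (λ a → coeff R n p a F.* coeff R n q (Vec.zipWith _∸_ m a))) (below°≡ R n m)) ⟩
    ∑ (below′ m) (λ a → coeff R n p a F.* coeff R n q (Vec.zipWith _∸_ m a))
      ≈⟨ ∑-cong (below′ m) (λ a → F.*-cong (coeff-norm n p a) (coeff-norm n q _)) ⟩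
    ∑ (below′ m) (λ a → coefT n (norm n p) a F.* coefT n (norm n q) (Vec.zipWith _∸_ m a))
      ≈⟨ coefT-* n (norm n p) (norm n q) m ⟨
    coefT n (norm n (p ⊗ q)) m ∎
    where open SetoidReasoning F.setoid

  ≃⇒norm : ∀ n p q → _≃_ R n p q → norm n p ≈[ n ] norm n q
  ≃⇒norm n p q e = coefT-injective n λ m → F.trans (F.sym (coeff-norm n p m)) (F.trans (e m) (coeff-norm n q m))

  norm⇒≃ : ∀ n p q → norm n p ≈[ n ] norm n q → _≃_ R n p q
  norm⇒≃ n p q e m = F.trans (coeff-norm n p m) (F.trans (coefT-cong n e m) (F.sym (coeff-norm n q m)))

-- Reasoning under double negation

infixl 1 _>>=_
-- The continuation may end in any negation; with a negated `B` this is the bind of the double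
-- negation monad.
_>>=_ : ∀ {a b} {A : Set a} {B : Set b} → ¬ ¬ A → (A → ¬ B) → ¬ B
(m >>= f) b = m λ a → f a b

return : ∀ {a} {A : Set a} → A → ¬ ¬ A
return a k = k a

-- The double negation shift, available because the index set is finite.
¬¬-∀-Fin : ∀ {p m} {P : Fin m → Set p} → (∀ i → ¬ ¬ P i) → ¬ ¬ (∀ i → P i)
¬¬-∀-Fin {m = zero}  f = return λ ()
¬¬-∀-Fin {m = suc m} f = do
  p ← f Fin.zero
  q ← ¬¬-∀-Fin (f ∘ Fin.suc)
  return λ { Fin.zero → p ; (Fin.suc i) → q i }

-- Spans, functionals and projections without decidable equality

module LinearAlgebra {c ℓ} (R : CommutativeRing c ℓ) (isField : IsField R) (n : ℕ) where
  open CommutativeRing R renaming (Carrier to F)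
  open SetoidReasoning setoid
  open IsField isField
  open NaturalCoefficients commutativeSemiring using (solve; _:+_; _:*_; _:=_)
  open RingProperties ring using (-1*x≈-x; -‿distribˡ-*)

  nonzero-* : ∀ {a b} → ¬ a ≈ 0# → ¬ b ≈ 0# → ¬ a * b ≈ 0#
  nonzero-* {a} {b} a≉0 b≉0 ab≈0 = let u , au≈1 = inverse a a≉0 in
    b≉0 (trans (sym (*-identityˡ b)) (trans (*-congʳ (trans (sym au≈1) (*-comm a u)))
      (trans (*-assoc u a b) (trans (*-congˡ ab≈0) (zeroʳ u)))))

  Form : Set c
  Form = LinForm R n

  infix 4 _≈ᵥ_
  _≈ᵥ_ : Form → Form → Set ℓ
  _≈ᵥ_ = _≈v_ R n

  infixl 6 _+ᵥ_
  infixr 7 _·ᵥ_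
  _+ᵥ_ : Form → Form → Form
  _+ᵥ_ = _+v_ R n

  _·ᵥ_ : F → Form → Form
  _·ᵥ_ = _·v_ R n

  0ᵥ : Form
  0ᵥ = 0v R n

  -- a wrapper around InSpan from which the list and the vector can be inferred
  record Span (X : List Form) (v : Form) : Set (c ⊔ ℓ) where
    constructor _,_
    field
      coeffs : Vec F (length X)
      combo  : v ≈ᵥ lc R n X coeffs
  open Span public

  toSpan : ∀ {X v} → InSpan R n X v → Span X v
  toSpan (as , p) = as , p

  fromSpan : ∀ {X v} → Span X v → InSpan R n X v
  fromSpan (as , p) = as , p

  +ᵥ-at : ∀ u v i → lookup (u +ᵥ v) i ≈ lookup u i + lookup v i
  +ᵥ-at u v i = reflexive (Vec.lookup-zipWith _+_ i u v)

  ·ᵥ-at : ∀ a v i → lookup (a ·ᵥ v) i ≈ a * lookup v i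
  ·ᵥ-at a v i = reflexive (Vec.lookup-map i (a *_) v)

  combo-at : ∀ a x w i → lookup (a ·ᵥ x +ᵥ w) i ≈ a * lookup x i + lookup w i
  combo-at a x w i = trans (+ᵥ-at (a ·ᵥ x) w i) (+-congʳ (·ᵥ-at a x i))

  0ᵥ-at : ∀ i → lookup 0ᵥ i ≈ 0#
  0ᵥ-at i = reflexive (Vec.lookup-replicate i 0#)

  lc-+ : ∀ X as bs i → lookup (lc R n X (Vec.zipWith _+_ as bs)) i ≈ lookup (lc R n X as) i + lookup (lc R n X bs) i
  lc-+ []      []       []       i = trans (0ᵥ-at i) (sym (trans (+-cong (0ᵥ-at i) (0ᵥ-at i)) (+-identityˡ 0#)))
  lc-+ (x ∷ X) (a ∷ as) (b ∷ bs) i = begin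
    lookup ((a + b) ·ᵥ x +ᵥ lc R n X (Vec.zipWith _+_ as bs)) i
      ≈⟨ trans (combo-at (a + b) x (lc R n X (Vec.zipWith _+_ as bs)) i) (+-congˡ (lc-+ X as bs i)) ⟩
    (a + b) * lookup x i + (lookup (lc R n X as) i + lookup (lc R n X bs) i)
      ≈⟨ solve 5 (λ a b x p q → (a :+ b) :* x :+ (p :+ q) := (a :* x :+ p) :+ (b :* x :+ q)) refl a b _ _ _ ⟩
    (a * lookup x i + lookup (lc R n X as) i) + (b * lookup x i + lookup (lc R n X bs) i)
      ≈⟨ +-cong (combo-at a x (lc R n X as) i) (combo-at b x (lc R n X bs) i) ⟨
    lookup (a ·ᵥ x +ᵥ lc R n X as) i + lookup (b ·ᵥ x +ᵥ lc R n X bs) i ∎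

  lc-· : ∀ X a as i → lookup (lc R n X (Vec.map (a *_) as)) i ≈ a * lookup (lc R n X as) i
  lc-· []      a []       i = trans (0ᵥ-at i) (sym (trans (*-congˡ (0ᵥ-at i)) (zeroʳ a)))
  lc-· (x ∷ X) a (b ∷ bs) i = begin
    lookup ((a * b) ·ᵥ x +ᵥ lc R n X (Vec.map (a *_) bs)) i
      ≈⟨ trans (combo-at (a * b) x (lc R n X (Vec.map (a *_) bs)) i) (+-congˡ (lc-· X a bs i)) ⟩
    a * b * lookup x i + a * lookup (lc R n X bs) i
      ≈⟨ trans (+-congʳ (*-assoc _ _ _)) (sym (distribˡ _ _ _)) ⟩
    a * (b * lookup x i + lookup (lc R n X bs) i)
      ≈⟨ *-congˡ (combo-at b x (lc R n X bs) i) ⟨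
    a * lookup (b ·ᵥ x +ᵥ lc R n X bs) i ∎

  span-cong : ∀ {X u v} → u ≈ᵥ v → Span X u → Span X v
  span-cong u≈v (as , p) = as , λ i → trans (sym (u≈v i)) (p i)

  span-[] : ∀ {v} → Span [] v → v ≈ᵥ 0ᵥ
  span-[] ([] , p) = p

  span-+ : ∀ {X u v} → Span X u → Span X v → Span X (u +ᵥ v)
  span-+ {X} {u} {v} (as , p) (bs , q) =
    Vec.zipWith _+_ as bs , λ i → trans (+ᵥ-at u v i) (trans (+-cong (p i) (q i)) (sym (lc-+ X as bs i)))

  span-· : ∀ {X v} a → Span X v → Span X (a ·ᵥ v)
  span-· {X} {v} a (as , p) =
    Vec.map (a *_) as , λ i → trans (·ᵥ-at a v i) (trans (*-congˡ (p i)) (sym (lc-· X a as i)))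

  span-0 : ∀ X → Span X 0ᵥ
  span-0 []      = [] , λ i → refl
  span-0 (x ∷ X) = let as , p = span-0 X in (0# ∷ as) , λ i → sym (begin
    lookup (0# ·ᵥ x +ᵥ lc R n X as) i  ≈⟨ trans (combo-at 0# x (lc R n X as) i) (+-congˡ (sym (p i))) ⟩
    0# * lookup x i + lookup 0ᵥ i       ≈⟨ trans (+-congʳ (zeroˡ _)) (+-identityˡ _) ⟩
    lookup 0ᵥ i                         ∎)

  span-uncons : ∀ {x X v} → Span (x ∷ X) v → Σ F λ a → Σ Form λ w → Span X w × v ≈ᵥ (a ·ᵥ x +ᵥ w)
  span-uncons {X = X} ((a ∷ as) , p) = a , lc R n X as , (as , λ i → refl) , p

  span-cons : ∀ {x X v w} a → Span X w → v ≈ᵥ (a ·ᵥ x +ᵥ w) → Span (x ∷ X) v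
  span-cons {x} {X} {v} {w} a (as , p) q =
    (a ∷ as) , λ i → trans (q i) (trans (+ᵥ-at (a ·ᵥ x) w i) (trans (+-congˡ (p i)) (sym (+ᵥ-at (a ·ᵥ x) (lc R n X as) i))))

  span-there : ∀ {x X v} → Span X v → Span (x ∷ X) v
  span-there {x} {X} {v} s = span-cons 0# s λ i → sym (begin
    lookup (0# ·ᵥ x +ᵥ v) i      ≈⟨ combo-at 0# x v i ⟩
    0# * lookup x i + lookup v i ≈⟨ trans (+-congʳ (zeroˡ _)) (+-identityˡ _) ⟩
    lookup v i                   ∎)

  span-here : ∀ x X → Span (x ∷ X) x
  span-here x X = span-cons 1# (span-0 X) λ i → sym (begin
    lookup (1# ·ᵥ x +ᵥ 0ᵥ) i      ≈⟨ trans (combo-at 1# x 0ᵥ i) (+-congˡ (0ᵥ-at i)) ⟩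
    1# * lookup x i + 0#          ≈⟨ trans (+-identityʳ _) (*-identityˡ _) ⟩
    lookup x i                    ∎)

  span-++ˡ : ∀ X Y {v} → Span X v → Span (X ++ Y) v
  span-++ˡ []      Y s = span-cong (λ i → sym (span-[] s i)) (span-0 Y)
  span-++ˡ (x ∷ X) Y s = let a , w , sw , p = span-uncons s in span-cons a (span-++ˡ X Y sw) p

  span-++ʳ : ∀ X Y {v} → Span Y v → Span (X ++ Y) v
  span-++ʳ []      Y s = s
  span-++ʳ (x ∷ X) Y s = span-there (span-++ʳ X Y s)

  span-++⁻ : ∀ X Y {v} → Span (X ++ Y) v → Σ Form λ u → Σ Form λ w → Span X u × Span Y w × v ≈ᵥ (u +ᵥ w)
  span-++⁻ []      Y {v} s = 0ᵥ , v , span-0 [] , s , λ i →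
    sym (trans (+ᵥ-at 0ᵥ v i) (trans (+-congʳ (0ᵥ-at i)) (+-identityˡ _)))
  span-++⁻ (x ∷ X) Y {v} s =
    let a , v′ , sv′ , p = span-uncons s
        u , w , su , sw , q = span-++⁻ X Y sv′
    in a ·ᵥ x +ᵥ u , w , span-cons a su (λ i → refl) , sw , λ i → begin
      lookup v i                              ≈⟨ trans (p i) (+ᵥ-at (a ·ᵥ x) v′ i) ⟩
      lookup (a ·ᵥ x) i + lookup v′ i         ≈⟨ +-congˡ (trans (q i) (+ᵥ-at u w i)) ⟩
      lookup (a ·ᵥ x) i + (lookup u i + lookup w i) ≈⟨ +-assoc _ _ _ ⟨
      lookup (a ·ᵥ x) i + lookup u i + lookup w i   ≈⟨ +-congʳ (+ᵥ-at (a ·ᵥ x) u i) ⟨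
      lookup (a ·ᵥ x +ᵥ u) i + lookup w i     ≈⟨ +ᵥ-at (a ·ᵥ x +ᵥ u) w i ⟨
      lookup (a ·ᵥ x +ᵥ u +ᵥ w) i             ∎

  span-take-mono : ∀ {j k} X → j ℕ.≤ k → ∀ {v} → Span (take j X) v → Span (take k X) v
  span-take-mono {zero}          X       j≤k s = span-cong (λ i → sym (span-[] s i)) (span-0 _)
  span-take-mono {suc j} {suc k} []      j≤k s = s
  span-take-mono {suc j} {suc k} (x ∷ X) (s≤s j≤k) s =
    let a , w , sw , p = span-uncons s in span-cons a (span-take-mono X j≤k sw) p

  span-take : ∀ j X {v} → Span (take j X) v → Span X v
  span-take zero    X       s = span-cong (λ i → sym (span-[] s i)) (span-0 _)
  span-take (suc j) []      s = s
  span-take (suc j) (x ∷ X) s = let a , w , sw , p = span-uncons s in span-cons a (span-take j X sw) p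

  +-neg : ∀ a → a + - 1# * a ≈ 0#
  +-neg a = trans (+-congˡ (-1*x≈-x a)) (-‿inverseʳ a)

  -- Each form avoids the span of those after it: the shape on which `projector` and `separator`
  -- recurse.
  data Independent : List Form → Set (c ⊔ ℓ) where
    []  : Independent []
    _∷_ : ∀ {x X} → ¬ Span X x → Independent X → Independent (x ∷ X)

  linIndep⇒independent : ∀ X → LinIndep R n X → Independent X
  linIndep⇒independent []      li = []
  linIndep⇒independent (x ∷ X) li = x∉X ∷ linIndep⇒independent X λ as p i →
    li (0# ∷ as) (λ j → trans (trans (combo-at 0# x (lc R n X as) j)
      (trans (+-congʳ (zeroˡ _)) (+-identityˡ _))) (p j)) (Fin.suc i)
    where
    x∉X : ¬ Span X x
    x∉X s = 0≉1 (sym (li (1# ∷ coeffs t) (λ i → begin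
      lookup (1# ·ᵥ x +ᵥ lc R n X (coeffs t)) i ≈⟨ trans (combo-at 1# x (lc R n X (coeffs t)) i) (+-congˡ (sym (combo t i))) ⟩
      1# * lookup x i + lookup ((- 1#) ·ᵥ x) i  ≈⟨ +-cong (*-identityˡ _) (·ᵥ-at (- 1#) x i) ⟩
      lookup x i + - 1# * lookup x i            ≈⟨ +-neg _ ⟩
      0#                                        ≈⟨ 0ᵥ-at i ⟨
      lookup 0ᵥ i                               ∎) Fin.zero))
      where
      t : Span X ((- 1#) ·ᵥ x)
      t = span-· (- 1#) s

  independent-take : ∀ j {X} → Independent X → Independent (take j X)
  independent-take zero    ind       = []
  independent-take (suc j) []        = []
  independent-take (suc j) (x∉X ∷ I) = (λ s → x∉X (span-take j _ s)) ∷ independent-take j I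

  Orth : List Form → List Form → Set (c ⊔ ℓ)
  Orth S I = ∀ v → Span S v → Span I v → v ≈ᵥ 0ᵥ

  -- If x = u + w with u in sp(S) and w in sp(I), then w = x - u lies in sp(x ∷ S) as well, so
  -- orthogonality makes it zero and x falls into sp(S).
  independent-++ : ∀ {S I} → Independent S → Independent I → Orth S I → Independent (S ++ I)
  independent-++ []                        indI orth = indI
  independent-++ {x ∷ S} {I} (x∉S ∷ indS) indI orth =
    (λ s → x∉S (x∈S (span-++⁻ S I s))) ∷ independent-++ indS indI (λ v s t → orth v (span-there s) t)
    where
    x∈S : (Σ Form λ u → Σ Form λ w → Span S u × Span I w × x ≈ᵥ (u +ᵥ w)) → Span S x
    x∈S (u , w , su , sw , p) = span-cong (λ i → sym (begin
        lookup x i              ≈⟨ trans (p i) (+ᵥ-at u w i) ⟩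
        lookup u i + lookup w i ≈⟨ +-congˡ (trans (w≈0 i) (0ᵥ-at i)) ⟩
        lookup u i + 0#         ≈⟨ +-identityʳ _ ⟩
        lookup u i              ∎)) su
      where
      w≈x-u : w ≈ᵥ (x +ᵥ (- 1#) ·ᵥ u)
      w≈x-u i = sym (begin
        lookup (x +ᵥ (- 1#) ·ᵥ u) i                      ≈⟨ trans (+ᵥ-at x ((- 1#) ·ᵥ u) i) (+-congˡ (·ᵥ-at (- 1#) u i)) ⟩
        lookup x i + - 1# * lookup u i                   ≈⟨ +-congʳ (trans (p i) (trans (+ᵥ-at u w i) (+-comm _ _))) ⟩
        lookup w i + lookup u i + - 1# * lookup u i      ≈⟨ trans (+-assoc _ _ _) (+-congˡ (+-neg _)) ⟩
        lookup w i + 0#                                  ≈⟨ +-identityʳ _ ⟩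
        lookup w i                                       ∎)
      w≈0 : w ≈ᵥ 0ᵥ
      w≈0 = orth w (span-cong (λ i → sym (w≈x-u i)) (span-+ (span-here x S) (span-· (- 1#) (span-there su)))) sw

  record Functional : Set (c ⊔ ℓ) where
    field
      fn     : Form → F
      cong   : ∀ u v → u ≈ᵥ v → fn u ≈ fn v
      +-homo : ∀ u v → fn (u +ᵥ v) ≈ fn u + fn v
      ·-homo : ∀ a v → fn (a ·ᵥ v) ≈ a * fn v
  open Functional public

  fn-combo : ∀ (f : Functional) {v} a x w → v ≈ᵥ (a ·ᵥ x +ᵥ w) → fn f v ≈ a * fn f x + fn f w
  fn-combo f a x w p = trans (cong f _ _ p) (trans (+-homo f _ w) (+-congʳ (·-homo f a x)))

  fn-0 : ∀ (f : Functional) v → v ≈ᵥ 0ᵥ → fn f v ≈ 0#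
  fn-0 f v p = trans (cong f v (0# ·ᵥ v) (λ i → trans (p i) (trans (0ᵥ-at i) (sym (trans (·ᵥ-at 0# v i) (zeroˡ _))))))
    (trans (·-homo f 0# v) (zeroˡ _))

  coordinate : Fin n → Functional
  coordinate i = record { fn = λ v → lookup v i ; cong = λ u v p → p i ; +-homo = λ u v → +ᵥ-at u v i ; ·-homo = λ a v → ·ᵥ-at a v i }

  0ᶠ : Functional
  0ᶠ = record { fn = λ v → 0# ; cong = λ _ _ _ → refl ; +-homo = λ _ _ → sym (+-identityˡ 0#) ; ·-homo = λ a _ → sym (zeroʳ a) }

  infixl 6 _+ᶠ_
  infixr 7 _·ᶠ_
  _+ᶠ_ : Functional → Functional → Functional
  f +ᶠ g = record
    { fn = λ v → fn f v + fn g v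
    ; cong = λ u v p → +-cong (cong f u v p) (cong g u v p)
    ; +-homo = λ u v → trans (+-cong (+-homo f u v) (+-homo g u v))
        (solve 4 (λ a b c d → (a :+ b) :+ (c :+ d) := (a :+ c) :+ (b :+ d)) refl _ _ _ _)
    ; ·-homo = λ a v → trans (+-cong (·-homo f a v) (·-homo g a v)) (sym (distribˡ _ _ _)) }

  _·ᶠ_ : F → Functional → Functional
  b ·ᶠ f = record
    { fn = λ v → b * fn f v
    ; cong = λ u v p → *-congˡ (cong f u v p)
    ; +-homo = λ u v → trans (*-congˡ (+-homo f u v)) (distribˡ _ _ _)
    ; ·-homo = λ a v → trans (*-congˡ (·-homo f a v)) (solve 3 (λ a b x → b :* (a :* x) := a :* (b :* x)) refl a b _) }

  apply : (Fin n → Functional) → Form → Form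
  apply P v = Vec.tabulate λ i → fn (P i) v

  apply-at : ∀ P v i → lookup (apply P v) i ≈ fn (P i) v
  apply-at P v i = reflexive (Vec.lookup∘tabulate (λ i → fn (P i) v) i)

  nonzero-entry : ∀ v → ¬ v ≈ᵥ 0ᵥ → ¬ ¬ (∃ λ i → ¬ lookup v i ≈ 0#)
  nonzero-entry v v≉0 none =
    ¬¬-∀-Fin (λ i v≉0ᵢ → none (i , v≉0ᵢ)) λ z → v≉0 λ i → trans (z i) (sym (0ᵥ-at i))

  -- Turns membership in sp(X) into equations: v lies in sp(X) exactly if all functionals
  -- `residue i`, the coordinates of v minus its projection, vanish at v.
  record Projector (X : List Form) : Set (c ⊔ ℓ) where
    field
      pr    : Fin n → Functional
      fixes : ∀ v → Span X v → ∀ i → fn (pr i) v ≈ lookup v i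
      image : ∀ v → Span X (apply pr v)

    residue : Fin n → Functional
    residue i = coordinate i +ᶠ (- 1# ·ᶠ pr i)

    residue-span : ∀ v → Span X v → ∀ i → fn (residue i) v ≈ 0#
    residue-span v s i = trans (+-congˡ (*-congˡ (fixes v s i))) (+-neg _)

    residue-zero : ∀ v → (∀ i → fn (residue i) v ≈ 0#) → Span X v
    residue-zero v z = span-cong (λ i → begin
      lookup (apply pr v) i                                  ≈⟨ apply-at pr v i ⟩
      fn (pr i) v                                            ≈⟨ +-identityˡ _ ⟨
      0# + fn (pr i) v                                       ≈⟨ +-congʳ (z i) ⟨
      lookup v i + - 1# * fn (pr i) v + fn (pr i) v           ≈⟨ +-assoc _ _ _ ⟩
      lookup v i + (- 1# * fn (pr i) v + fn (pr i) v)         ≈⟨ +-congˡ (trans (+-comm _ _) (+-neg _)) ⟩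
      lookup v i + 0#                                       ≈⟨ +-identityʳ _ ⟩
      lookup v i                                            ∎) (image v)

    -- Some coordinate of the residue is nonzero at b; that coordinate, divided by its value there,
    -- is the functional.
    dual : ∀ b → ¬ Span X b → ¬ ¬ (Σ Functional λ g → (∀ v → Span X v → fn g v ≈ 0#) × fn g b ≈ 1#)
    dual b b∉X = do
      j , r≉0 ← nonzero-entry (apply residue b) λ z → b∉X (residue-zero b λ i →
        trans (sym (apply-at residue b i)) (trans (z i) (0ᵥ-at i)))
      let u , ru≈1 = inverse _ r≉0
      return ((u ·ᶠ residue j) , (λ v s → trans (*-congˡ (residue-span v s j)) (zeroʳ u)) ,
        trans (*-comm _ _) (trans (*-congʳ (sym (apply-at residue b j))) ru≈1))

  open Projector public

  agree-cons : ∀ {x X} (f g : Functional) → fn f x ≈ fn g x → (∀ v → Span X v → fn f v ≈ fn g v) →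
               ∀ v → Span (x ∷ X) v → fn f v ≈ fn g v
  agree-cons {x} f g p q v s =
    let a , w , sw , e = span-uncons s in
    trans (fn-combo f a x w e) (trans (+-cong (*-congˡ p) (q w sw)) (sym (fn-combo g a x w e)))

  -- A rank-one correction: where g vanishes the map P is unchanged, and if g is 1 at b then b
  -- becomes a fixed point.
  extend : (Fin n → Functional) → Functional → Form → Fin n → Functional
  extend P g b i = P i +ᶠ (lookup b i + - 1# * fn (P i) b) ·ᶠ g

  extend-span : ∀ P g b v → fn g v ≈ 0# → ∀ i → fn (extend P g b i) v ≈ fn (P i) v
  extend-span P g b v z i = trans (+-congˡ (trans (*-congˡ z) (zeroʳ _))) (+-identityʳ _)

  extend-new : ∀ P g b → fn g b ≈ 1# → ∀ i → fn (extend P g b i) b ≈ lookup b i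
  extend-new P g b o i = begin
    fn (P i) b + (lookup b i + - 1# * fn (P i) b) * fn g b  ≈⟨ +-congˡ (trans (*-congˡ o) (*-identityʳ _)) ⟩
    fn (P i) b + (lookup b i + - 1# * fn (P i) b)           ≈⟨ solve 3 (λ p q r → p :+ (q :+ r) := q :+ (p :+ r)) refl _ _ _ ⟩
    lookup b i + (fn (P i) b + - 1# * fn (P i) b)           ≈⟨ trans (+-congˡ (+-neg _)) (+-identityʳ _) ⟩
    lookup b i                                              ∎

  projector-cons : ∀ {x X} (p : Projector X) (g : Functional) → (∀ v → Span X v → fn g v ≈ 0#) → fn g x ≈ 1# → Projector (x ∷ X)
  projector-cons {x} {X} p g g0 g1 = record
    { pr = π′
    ; fixes = λ v s i → agree-cons (π′ i) (coordinate i) (extend-new (pr p) g x g1 i)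
        (λ w sw → trans (extend-span (pr p) g x w (g0 w sw) i) (fixes p w sw i)) v s
    ; image = λ v → span-cong (λ i → sym (begin
        lookup (apply π′ v) i                                            ≈⟨ apply-at π′ v i ⟩
        fn (pr p i) v + (lookup x i + - 1# * fn (pr p i) x) * fn g v       ≈⟨ solve 5 (λ a x m y g → a :+ (x :+ m :* y) :* g := a :+ g :* (x :+ m :* y)) refl _ _ _ _ _ ⟩
        fn (pr p i) v + fn g v * (lookup x i + - 1# * fn (pr p i) x)       ≈⟨ +-cong (apply-at (pr p) v i) (*-congˡ (trans (+ᵥ-at x ((- 1#) ·ᵥ apply (pr p) x) i) (+-congˡ (trans (·ᵥ-at (- 1#) (apply (pr p) x) i) (*-congˡ (apply-at (pr p) x i)))))) ⟨
        lookup (apply (pr p) v) i + fn g v * lookup (x +ᵥ (- 1#) ·ᵥ apply (pr p) x) i  ≈⟨ trans (+ᵥ-at (apply (pr p) v) (fn g v ·ᵥ (x +ᵥ (- 1#) ·ᵥ apply (pr p) x)) i) (+-congˡ (·ᵥ-at (fn g v) (x +ᵥ (- 1#) ·ᵥ apply (pr p) x) i)) ⟨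
        lookup (apply (pr p) v +ᵥ fn g v ·ᵥ (x +ᵥ (- 1#) ·ᵥ apply (pr p) x)) i ∎))
        (span-+ (span-there (image p v)) (span-· (fn g v) (span-+ (span-here x X) (span-· (- 1#) (span-there (image p x)))))) }
    where
    π′ = extend (pr p) g x

  projector : ∀ {X} → Independent X → ¬ ¬ Projector X
  projector []          = return record
    { pr = λ _ → 0ᶠ
    ; fixes = λ v s i → sym (trans (span-[] s i) (0ᵥ-at i))
    ; image = λ v → span-cong (λ i → sym (trans (apply-at (λ _ → 0ᶠ) v i) (sym (0ᵥ-at i)))) (span-0 []) }
  projector (x∉X ∷ ind) = do
    p ← projector ind
    g , g0 , g1 ← dual p _ x∉X
    return (projector-cons p g g0 g1)

  -- A linear map that reduces modulo I without moving sp(S); it is unconstrained beyond sp(S ∪ I).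
  record Separator (S I : List Form) : Set (c ⊔ ℓ) where
    field
      P     : Fin n → Functional
      kills : ∀ v → Span I v → ∀ i → fn (P i) v ≈ 0#
      keeps : ∀ v → Span S v → ∀ i → fn (P i) v ≈ lookup v i
  open Separator public

  -- Starts from the zero map and makes the forms of S fixed points one at a time. The projector
  -- onto sp(S ∪ I) is carried along because it supplies the dual functional for the next form,
  -- which must vanish on I and on the forms already treated.
  separator : ∀ S I → Independent (S ++ I) → ¬ ¬ (Projector (S ++ I) × Separator S I)
  separator []      I ind = do
    p ← projector ind
    return (p , record { P = λ _ → 0ᶠ ; kills = λ _ _ _ → refl ; keeps = λ v s i → sym (trans (span-[] s i) (0ᵥ-at i)) })
  separator (x ∷ S) I (x∉ ∷ ind) = do
    p , q ← separator S I ind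
    g , g0 , g1 ← dual p x x∉
    return (projector-cons p g g0 g1 , record
      { P = extend (P q) g x
      ; kills = λ v s i → trans (extend-span (P q) g x v (g0 v (span-++ʳ S I s)) i) (kills q v s i)
      ; keeps = λ v s i → agree-cons (extend (P q) g x i) (coordinate i) (extend-new (P q) g x g1 i)
          (λ w sw → trans (extend-span (P q) g x w (g0 w (span-++ˡ S I sw)) i) (keeps q w sw i)) v s })

-- Leading coefficients along the flag of an ordered form-ideal

module Leading {c ℓ} (R : CommutativeRing c ℓ) (isField : IsField R) (n : ℕ) where
  open CommutativeRing R renaming (Carrier to F)
  open IsField isField
  open LinearAlgebra R isField n

  prefix : ∀ {m} → (Fin m → Functional) → (ℕ → Functional) → ℕ → Functional
  prefix {zero}  f h s       = h s
  prefix {suc m} f h zero    = f Fin.zero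
  prefix {suc m} f h (suc s) = prefix (f ∘ Fin.suc) h s

  prefix-∀ : ∀ {m p} {P : Functional → Set p} (f : Fin m → Functional) (h : ℕ → Functional) t →
             (∀ i → P (f i)) → (∀ s → s ℕ.< t → P (h s)) → ∀ s → s ℕ.< m ℕ.+ t → P (prefix f h s)
  prefix-∀ {zero}  f h t pf ph s       s<t       = ph s s<t
  prefix-∀ {suc m} f h t pf ph zero    s<t       = pf Fin.zero
  prefix-∀ {suc m} {P = P} f h t pf ph (suc s) (s≤s s<t) = prefix-∀ {P = P} (f ∘ Fin.suc) h t (pf ∘ Fin.suc) ph s s<t

  prefix-left : ∀ {m p} {P : Functional → Set p} (f : Fin m → Functional) (h : ℕ → Functional) →
                (∀ s → s ℕ.< m → P (prefix f h s)) → ∀ i → P (f i)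
  prefix-left {suc m} f h q Fin.zero    = q 0 (s≤s z≤n)
  prefix-left {suc m} {P = P} f h q (Fin.suc i) = prefix-left {P = P} (f ∘ Fin.suc) h (λ s s<m → q (suc s) (s≤s s<m)) i

  prefix-right : ∀ {m p} {P : Functional → Set p} (f : Fin m → Functional) (h : ℕ → Functional) t →
                 (∀ s → s ℕ.< m ℕ.+ t → P (prefix f h s)) → ∀ s → s ℕ.< t → P (h s)
  prefix-right {zero}  f h t q = q
  prefix-right {suc m} {P = P} f h t q = prefix-right {P = P} (f ∘ Fin.suc) h t (λ s s<m → q (suc s) (s≤s s<m))

  -- The first nonzero value of v under the sequence h serves as leading coefficient of v:
  -- vectors of sp_j do not affect it unless v itself lies in sp_j.
  record Flag (I : List Form) : Set (c ⊔ ℓ) where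
    field
      h         : ℕ → Functional
      threshold : ∀ j → Σ ℕ λ t → (∀ v → Span (take j I) v → ∀ s → s ℕ.< t → fn (h s) v ≈ 0#) ×
                                  (∀ v → (∀ s → s ℕ.< t → fn (h s) v ≈ 0#) → Span (take j I) v)

  -- The sequence consists of blocks of n residues, for sp_N with N = `length I`, then sp_(N-1), and
  -- so on down to sp_0. As the spans are nested, the blocks down to that of sp_j all vanish on
  -- sp_j, and the last of them detects it; the threshold of j is the end of that block.
  flag : ∀ {I} → Independent I → ¬ ¬ Flag I
  flag {I} ind = do
    -- One more projector than there are forms, since the empty prefix sp_0 needs its own.
    p ← ¬¬-∀-Fin {m = suc (length I)} (λ j → projector (independent-take (toℕ j) ind))
    return (build p)
    where
    Thresholds : (ℕ → Functional) → ℕ → Set (c ⊔ ℓ)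
    Thresholds h j = Σ ℕ λ t → (∀ v → Span (take j I) v → ∀ s → s ℕ.< t → fn (h s) v ≈ 0#) ×
                               (∀ v → (∀ s → s ℕ.< t → fn (h s) v ≈ 0#) → Span (take j I) v)

    module _ (p : (j : ℕ) → j ℕ.≤ length I → Projector (take j I)) where
      seq : ∀ N → N ℕ.≤ length I → ℕ → Functional
      seq zero    le = prefix (residue (p 0 le)) (λ _ → 0ᶠ)
      seq (suc N) le = prefix (residue (p (suc N) le)) (seq N (ℕ.≤-trans (ℕ.n≤1+n N) le))

      top : ∀ N le (h : ℕ → Functional) → Thresholds (prefix (residue (p N le)) h) N
      top N le h = n , (λ v sv s s<n → prefix-∀ {P = λ f → fn f v ≈ 0#} (residue (p N le)) h 0 (residue-span (p N le) v sv) (λ _ ())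
                         s (ℕ.≤-trans s<n (ℕ.≤-reflexive (≡.sym (ℕ.+-identityʳ n)))))
                     , (λ v z → residue-zero (p N le) v (prefix-left {P = λ f → fn f v ≈ 0#} (residue (p N le)) h z))

      thresholds : ∀ N le j → j ℕ.≤ N → Thresholds (seq N le) j
      thresholds zero    le zero j≤N = top 0 le _
      thresholds (suc N) le j    j≤N with ℕ.m≤n⇒m<n∨m≡n j≤N
      ... | inj₂ ≡.refl      = top (suc N) le _
      ... | inj₁ (s≤s j≤N′) = let t , q , r = thresholds N (ℕ.≤-trans (ℕ.n≤1+n N) le) j j≤N′ in
        n ℕ.+ t ,
        (λ v sv → prefix-∀ {P = λ f → fn f v ≈ 0#} (residue (p (suc N) le)) _ t (residue-span (p (suc N) le) v (span-take-mono I j≤N sv)) (q v sv)) ,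
        (λ v z → r v (prefix-right {P = λ f → fn f v ≈ 0#} (residue (p (suc N) le)) _ t z))

      all-thresholds : ∀ j → Thresholds (seq (length I) ℕ.≤-refl) j
      all-thresholds j with ℕ.≤-total j (length I)
      ... | inj₁ j≤I = thresholds (length I) ℕ.≤-refl j j≤I
      -- The index `j` in the shape of a matching is an arbitrary number; past `length I` the prefix
      -- is all of I.
      ... | inj₂ I≤j = ≡.subst
        (λ X → Σ ℕ λ t → (∀ v → Span X v → ∀ s → s ℕ.< t → fn (seq (length I) ℕ.≤-refl s) v ≈ 0#) ×
                         (∀ v → (∀ s → s ℕ.< t → fn (seq (length I) ℕ.≤-refl s) v ≈ 0#) → Span X v))
        (≡.trans (List.take-all (length I) I ℕ.≤-refl) (≡.sym (List.take-all j I I≤j)))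
        (thresholds (length I) ℕ.≤-refl (length I) ℕ.≤-refl)

    build : (∀ j → Projector (take (toℕ {suc (length I)} j) I)) → Flag I
    build p = record { h = seq p′ (length I) ℕ.≤-refl ; threshold = all-thresholds p′ }
      where
      p′ : (j : ℕ) → j ℕ.≤ length I → Projector (take j I)
      p′ j le = ≡.subst (λ k → Projector (take k I)) (Fin.toℕ-fromℕ< (s≤s le)) (p (Fin.fromℕ< (s≤s le)))

  module _ {I : List Form} (𝓕 : Flag I) where
    open Flag 𝓕

    -- A relation and not a function of v: finding the position would require a zero test.
    record Lead (v : Form) (a : F) : Set ℓ where
      constructor lead
      field
        pos     : ℕ
        before  : ∀ s → s ℕ.< pos → fn (h s) v ≈ 0#
        nonzero : ¬ a ≈ 0#
        value   : a ≈ fn (h pos) v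

    lead-unique : ∀ {u v a b} → u ≈ᵥ v → Lead u a → Lead v b → a ≈ b
    lead-unique {u} {v} u≈v (lead s p a≉0 a≈) (lead t q b≉0 b≈) with ℕ.<-cmp s t
    ... | tri≈ _ ≡.refl _ = trans a≈ (trans (cong (h s) u v u≈v) (sym b≈))
    ... | tri< s<t _ _    = ⊥-elim (a≉0 (trans a≈ (trans (cong (h s) u v u≈v) (q s s<t))))
    ... | tri> _ _ t<s    = ⊥-elim (b≉0 (trans b≈ (trans (sym (cong (h t) u v u≈v)) (p t t<s))))

    -- As u lies outside sp_j, its position is below the threshold of j, and there every functional
    -- kills w. So v behaves like d times u up to and including that position.
    lead-step : ∀ {u v w a} j d → ¬ d ≈ 0# → v ≈ᵥ (d ·ᵥ u +ᵥ w) → Span (take j I) w → ¬ Span (take j I) u →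
                Lead u a → Lead v (d * a)
    lead-step {u} {v} {w} {a} j d d≉0 e sw u∉ (lead s p a≉0 a≈) with threshold j
    ... | t , q , r with ℕ.<-≤-connex s t
    ...   | inj₂ t≤s = ⊥-elim (u∉ (r u λ k k<t → p k (ℕ.≤-trans k<t t≤s)))
    ...   | inj₁ s<t = lead s
      (λ k k<s → trans (scaled k (ℕ.<-trans k<s s<t)) (trans (*-congˡ (p k k<s)) (zeroʳ d)))
      (nonzero-* d≉0 a≉0)
      (trans (*-congˡ a≈) (sym (scaled s s<t)))
      where
      scaled : ∀ k → k ℕ.< t → fn (h k) v ≈ d * fn (h k) u
      scaled k k<t = trans (fn-combo (h k) d u w e) (trans (+-congˡ (q w sw k k<t)) (+-identityʳ _))

    -- The search is bounded by the threshold of sp_0 = 0: a form on which all functionals below it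
    -- vanish is zero.
    lead-exists : ∀ v → ¬ v ≈ᵥ 0ᵥ → ¬ ¬ (∃ λ a → Lead v a)
    lead-exists v v≉0 with threshold 0
    ... | t , _ , r = search t λ z → v≉0 (span-[] (r v z))
      where
      search : ∀ t → ¬ (∀ s → s ℕ.< t → fn (h s) v ≈ 0#) → ¬ ¬ (∃ λ a → Lead v a)
      search zero    ne = ⊥-elim (ne λ _ ())
      search (suc t) ne = do
        yes z ← ¬¬-excluded-middle {A = ∀ s → s ℕ.< t → fn (h s) v ≈ 0#}
          where no ne′ → search t ne′
        return (fn (h t) v , lead t z
          (λ ht≈0 → ne λ { s (s≤s s≤t) → case ℕ.m≤n⇒m<n∨m≡n s≤t of λ { (inj₁ s<t) → z s s<t ; (inj₂ ≡.refl) → ht≈0 } }) refl)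

-- Linear forms as polynomials, and substitutions

module LinearForms {c ℓ} (R : CommutativeRing c ℓ) (isField : IsField R) where
  open CommutativeRing R renaming (Carrier to F)
  open IsField isField
  open Multivariate R
  private
    module 𝕋 n = CommutativeRing (𝕋 n)

  lin : ∀ {n} → Vec F n → ∣𝕋 n ∣
  lin []            = 0#
  lin {suc n} (a ∷ v) = lin v ∷ Hom.fn (cst n) a ∷ []

  unit-cst : ∀ n {a} → ¬ a ≈ 0# → Regular (𝕋 n) (Hom.fn (cst n) a)
  unit-cst n {a} a≉0 = Regularity.unit-regular (𝕋 n) {u = Hom.fn (cst n) u}
    (𝕋.trans n (𝕋.sym n (Hom.*-homo (cst n) u a)) (𝕋.trans n (Hom.cong (cst n) (trans (*-comm u a) au≈1)) (Hom.1-homo (cst n))))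
    where
    u = proj₁ (inverse a a≉0)
    au≈1 = proj₂ (inverse a a≉0)

  -- Either the outermost variable has an invertible coefficient, or the part free of that variable
  -- is regular by induction.
  lin-regular : ∀ {n} (v : Vec F n) i → ¬ lookup v i ≈ 0# → Regular (𝕋 n) (lin v)
  lin-regular {suc n} (a ∷ v) Fin.zero    a≉0 = Regularity.linear-regular-high (𝕋 n) (unit-cst n a≉0)
  lin-regular {suc n} (a ∷ v) (Fin.suc i) vᵢ≉0 = Regularity.linear-regular-low (𝕋 n) (lin-regular v i vᵢ≉0)

  lin-cong : ∀ {n} (u v : Vec F n) → (∀ i → lookup u i ≈ lookup v i) → lin u ≈[ n ] lin v
  lin-cong []      []      p = refl
  lin-cong {suc n} (a ∷ u) (b ∷ v) p = Univariate.coefwise λ where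
    zero          → lin-cong u v (p ∘ Fin.suc)
    (suc zero)    → Hom.cong (cst n) (p Fin.zero)
    (suc (suc k)) → 𝕋.refl n

  lin-+ : ∀ {n} (u v : Vec F n) → lin (Vec.zipWith _+_ u v) ≈[ n ] 𝕋._+_ n (lin u) (lin v)
  lin-+ []      []      = sym (+-identityˡ 0#)
  lin-+ {suc n} (a ∷ u) (b ∷ v) = Univariate.coefwise λ where
    zero          → lin-+ u v
    (suc zero)    → Hom.+-homo (cst n) a b
    (suc (suc k)) → 𝕋.refl n

  cst-* : ∀ n a f k → Univariate.coef (𝕋 n) (𝕋._*_ (suc n) (Hom.fn (cst (suc n)) a) f) k
          ≈[ n ] 𝕋._*_ n (Hom.fn (cst n) a) (Univariate.coef (𝕋 n) f k)
  cst-* n a f k = 𝕋.trans n (coef-* (b ∷ []) f k) (single k)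
    where
    open Univariate (𝕋 n)
    b = Hom.fn (cst n) a
    single : ∀ k → conv (coef (b ∷ [])) (coef f) k ≈[ n ] 𝕋._*_ n b (coef f k)
    single zero    = 𝕋.refl n
    single (suc k) = 𝕋.trans n (𝕋.+-congˡ n (conv-zeroˡ (coef f) k)) (𝕋.+-identityʳ n _)

  lin-· : ∀ {n} a (v : Vec F n) → lin (Vec.map (a *_) v) ≈[ n ] 𝕋._*_ n (Hom.fn (cst n) a) (lin v)
  lin-· a []      = sym (zeroʳ a)
  lin-· {suc n} a (b ∷ v) = Univariate.coefwise λ k → 𝕋.trans n (go k) (𝕋.sym n (cst-* n a (lin (b ∷ v)) k))
    where
    open Univariate (𝕋 n)
    go : ∀ k → coef (lin (Vec.map (a *_) (b ∷ v))) k ≈[ n ] 𝕋._*_ n (Hom.fn (cst n) a) (coef (lin (b ∷ v)) k)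
    go zero          = lin-· a v
    go (suc zero)    = Hom.*-homo (cst n) a b
    go (suc (suc k)) = 𝕋.sym n (𝕋.zeroʳ n _)

  module _ {b ℓ′} {B : CommutativeRing b ℓ′} (g : Hom R B) where
    private module B = CommutativeRing B
    open SetoidReasoning B.setoid

    combine : ∀ {m} → Vec F m → (Fin m → B.Carrier) → B.Carrier
    combine []      y = B.0#
    combine (a ∷ v) y = Hom.fn g a B.* y Fin.zero B.+ combine v (y ∘ Fin.suc)

    substitute : ∀ m → (Fin m → B.Carrier) → Hom (𝕋 m) B
    substitute zero    y = g
    substitute (suc m) y = Evaluation.evaluation (substitute m (y ∘ Fin.suc)) (y Fin.zero)

    substitute-cst : ∀ m y a → Hom.fn (substitute m y) (Hom.fn (cst m) a) B.≈ Hom.fn g a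
    substitute-cst zero    y a = B.refl
    substitute-cst (suc m) y a = B.trans (Evaluation.eval-const (substitute m (y ∘ Fin.suc)) (y Fin.zero) _) (substitute-cst m (y ∘ Fin.suc) a)

    substitute-lin : ∀ m y (v : Vec F m) → Hom.fn (substitute m y) (lin v) B.≈ combine v y
    substitute-lin zero    y []      = Hom.0-homo g
    substitute-lin (suc m) y (a ∷ v) = begin
      Hom.fn σ (lin v) B.+ y Fin.zero B.* (Hom.fn σ (Hom.fn (cst m) a) B.+ y Fin.zero B.* B.0#)
        ≈⟨ B.+-cong (substitute-lin m _ v) (B.*-congˡ (B.trans (B.+-congˡ (B.zeroʳ _)) (B.trans (B.+-identityʳ _) (substitute-cst m _ a)))) ⟩
      combine v (y ∘ Fin.suc) B.+ y Fin.zero B.* Hom.fn g a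
        ≈⟨ B.trans (B.+-comm _ _) (B.+-congʳ (B.*-comm _ _)) ⟩
      Hom.fn g a B.* y Fin.zero B.+ combine v (y ∘ Fin.suc) ∎
      where σ = substitute m (y ∘ Fin.suc)

    unit : ∀ {m} → Fin m → Vec F m
    unit Fin.zero    = 1# ∷ Vec.replicate _ 0#
    unit (Fin.suc i) = 0# ∷ unit i

    -- A linear map is determined by the images of the unit vectors. Together with `substitute-lin`
    -- this extends a linear map on forms to a ring homomorphism.
    linear-combine : ∀ {m} (f : Vec F m → B.Carrier) →
      (∀ u v → (∀ i → lookup u i ≈ lookup v i) → f u B.≈ f v) →
      (∀ u v → f (Vec.zipWith _+_ u v) B.≈ f u B.+ f v) →
      (∀ a v → f (Vec.map (a *_) v) B.≈ Hom.fn g a B.* f v) →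
      ∀ v → f v B.≈ combine v (f ∘ unit)
    linear-combine f f-cong f-+ f-· []      = B.trans (f-cong [] (Vec.map (0# *_) []) (λ ())) (B.trans (f-· 0# []) (B.trans (B.*-congʳ (Hom.0-homo g)) (B.zeroˡ _)))
    linear-combine {suc m} f f-cong f-+ f-· (a ∷ v) = begin
      f (a ∷ v)
        ≈⟨ f-cong (a ∷ v) (Vec.zipWith _+_ (Vec.map (a *_) (unit Fin.zero)) (0# ∷ v)) split ⟩
      f (Vec.zipWith _+_ (Vec.map (a *_) (unit Fin.zero)) (0# ∷ v))
        ≈⟨ B.trans (f-+ _ _) (B.+-congʳ (f-· a _)) ⟩
      Hom.fn g a B.* f (unit Fin.zero) B.+ f (0# ∷ v)
        ≈⟨ B.+-congˡ (linear-combine (f ∘ (0# ∷_))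
             (λ u w p → f-cong _ _ λ { Fin.zero → refl ; (Fin.suc i) → p i })
             (λ u w → B.trans (f-cong _ _ λ { Fin.zero → sym (+-identityˡ 0#) ; (Fin.suc i) → refl }) (f-+ (0# ∷ u) (0# ∷ w)))
             (λ b w → B.trans (f-cong _ _ λ { Fin.zero → sym (zeroʳ b) ; (Fin.suc i) → refl }) (f-· b (0# ∷ w))) v) ⟩
      combine (a ∷ v) (f ∘ unit) ∎
      where
      split : ∀ i → lookup (a ∷ v) i ≈ lookup (Vec.zipWith _+_ (Vec.map (a *_) (unit Fin.zero)) (0# ∷ v)) i
      split Fin.zero    = sym (trans (+-identityʳ _) (*-identityʳ a))
      split (Fin.suc i) = sym (trans (reflexive (Vec.lookup-zipWith _+_ i (Vec.map (a *_) (Vec.replicate m 0#)) v))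
        (trans (+-congʳ (trans (reflexive (≡.trans (Vec.lookup-map i (a *_) (Vec.replicate m 0#)) (≡.cong (a *_) (Vec.lookup-replicate i 0#)))) (zeroʳ a))) (+-identityˡ _)))

  combine-X : ∀ {n} (v : Vec F n) → combine (cst n) v X ≈[ n ] lin v
  combine-X []      = refl
  combine-X {suc n} (a ∷ v) = Univariate.coefwise λ k →
    𝕋.trans n (Univariate.coef-+ (𝕋 n) (𝕋._*_ (suc n) (Hom.fn (cst (suc n)) a) (X {suc n} Fin.zero)) (combine (cst (suc n)) v (X ∘ Fin.suc)) k)
      (𝕋.trans n (𝕋.+-cong n (cst-* n a (X {suc n} Fin.zero) k) (Univariate._≋_.at (embed v X) k)) (go k))
    where
    embed : ∀ {m} (w : Vec F m) y → combine (cst (suc n)) w (λ i → y i ∷ []) ≈[ suc n ] (combine (cst n) w y ∷ [])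
    embed []      y = Univariate.coefwise λ { zero → 𝕋.refl n ; (suc k) → 𝕋.refl n }
    embed (b ∷ w) y = 𝕋.trans (suc n) (𝕋.+-cong (suc n) (𝕋.sym (suc n) (Hom.*-homo (Univariate.constant (𝕋 n)) _ _)) (embed w (y ∘ Fin.suc))) (𝕋.refl (suc n))
    go : ∀ k → 𝕋._+_ n (𝕋._*_ n (Hom.fn (cst n) a) (Univariate.coef (𝕋 n) (X {suc n} Fin.zero) k)) (Univariate.coef (𝕋 n) (combine (cst n) v X ∷ []) k)
         ≈[ n ] Univariate.coef (𝕋 n) (lin (a ∷ v)) k
    go zero          = 𝕋.trans n (𝕋.+-congʳ n (𝕋.zeroʳ n _)) (𝕋.trans n (𝕋.+-identityˡ n _) (combine-X v))
    go (suc zero)    = 𝕋.trans n (𝕋.+-identityʳ n _) (𝕋.*-identityʳ n _)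
    go (suc (suc k)) = 𝕋.trans n (𝕋.+-identityʳ n _) (𝕋.zeroʳ n _)

  norm-linP : ∀ {n} (v : Vec F n) → norm n (linP R n v) ≈[ n ] lin v
  norm-linP {n} v = 𝕋.trans n (go v id) (combine-X v)
    where
    go : ∀ {m} (w : Vec F m) (y : Fin m → Fin n) →
         norm n (sumP R n (Vec.toList (Vec.zipWith (λ a i → con a ⊗ var i) w (Vec.tabulate y)))) ≈[ n ] combine (cst n) w (X ∘ y)
    go []      y = Hom.0-homo (cst n)
    go (a ∷ w) y = 𝕋.+-congˡ n (go w (y ∘ Fin.suc))

-- Lists of forms up to scaling

module Scaling {c ℓ} (R : CommutativeRing c ℓ) (isField : IsField R) (n : ℕ) where
  open CommutativeRing R renaming (Carrier to F)
  open IsField isField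
  open LinearAlgebra R isField n

  infix 4 _∼[_]_
  record _∼[_]_ (x : Form) (a : F) (y : Form) : Set ℓ where
    constructor _,_
    field
      factor≉0 : ¬ a ≈ 0#
      scaling  : x ≈ᵥ a ·ᵥ y

  ∼-refl : ∀ x → x ∼[ 1# ] x
  ∼-refl x = (λ 1≈0 → 0≉1 (sym 1≈0)) , λ i → sym (trans (·ᵥ-at 1# x i) (*-identityˡ _))

  -- The index accumulates the product of the factors, which is the scalar between the two products
  -- of forms.
  data Scaled : F → List Form → List Form → Set (c ⊔ ℓ) where
    []  : Scaled 1# [] []
    _∷_ : ∀ {a b x y xs ys} → x ∼[ a ] y → Scaled b xs ys → Scaled (a * b) (x ∷ xs) (y ∷ ys)

  scaled-refl : ∀ xs → ∃ λ a → Scaled a xs xs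
  scaled-refl []       = 1# , []
  scaled-refl (x ∷ xs) = let a , s = scaled-refl xs in
    1# * a , ∼-refl x ∷ s

  span-unscale : ∀ {X x y a} → x ∼[ a ] y → Span X x → Span X y
  span-unscale {X} {x} {y} {a} (a≉0 , x≈ay) s = let u , au≈1 = inverse a a≉0 in
    span-cong (λ i → trans (·ᵥ-at u x i) (trans (*-congˡ (trans (x≈ay i) (·ᵥ-at a y i)))
      (trans (sym (*-assoc _ _ _)) (trans (*-congʳ (trans (*-comm u a) au≈1)) (*-identityˡ _))))) (span-· u s)

  span-scale : ∀ {X x y a} → x ∼[ a ] y → Span X y → Span X x
  span-scale {a = a} (_ , x≈ay) s = span-cong (λ i → sym (x≈ay i)) (span-· a s)

  -- What a cancellation of two lists becomes when every remaining form lies in sp(S), where weights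
  -- are the identity.
  record Alike (S A B : List Form) : Set (c ⊔ ℓ) where
    field
      common₁ common₂ rest₁ rest₂ : List Form
      perm₁  : A ↭ common₁ ++ rest₁
      perm₂  : B ↭ common₂ ++ rest₂
      ratio  : F
      scaled : Scaled ratio common₁ common₂
      rest₁⊆ : All (Span S) rest₁
      rest₂⊆ : All (Span S) rest₂

  alike-refl : ∀ S A → Alike S A A
  alike-refl S A = record
    { common₁ = A ; common₂ = A ; rest₁ = [] ; rest₂ = []
    ; perm₁ = ≡.subst (A ↭_) (≡.sym (List.++-identityʳ A)) Perm.refl ; perm₂ = ≡.subst (A ↭_) (≡.sym (List.++-identityʳ A)) Perm.refl
    ; ratio = proj₁ (scaled-refl A) ; scaled = proj₂ (scaled-refl A) ; rest₁⊆ = [] ; rest₂⊆ = [] }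

-- From the blocking relation to a vanishing subsum

module Cancellation {c ℓ} (R : CommutativeRing c ℓ) (isField : IsField R) (n : ℕ) where
  open CommutativeRing R renaming (Carrier to F)
  open IsField isField
  open LinearAlgebra R isField n
  open Leading R isField n
  open Multivariate R
  open LinearForms R isField
  open Scaling R isField n
  private
    module 𝕋 = CommutativeRing (𝕋 n)
  open NaturalCoefficients 𝕋.commutativeSemiring using (solve; _:+_; _:*_; _:=_)

  const : F → 𝕋.Carrier
  const = Hom.fn (cst n)

  const-* : ∀ a b → const (a * b) 𝕋.≈ const a 𝕋.* const b
  const-* = Hom.*-homo (cst n)

  ∏ : (Form → 𝕋.Carrier) → List Form → 𝕋.Carrier
  ∏ f []       = 𝕋.1#
  ∏ f (x ∷ xs) = f x 𝕋.* ∏ f xs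

  ∏-++ : ∀ f xs ys → ∏ f (xs ++ ys) 𝕋.≈ ∏ f xs 𝕋.* ∏ f ys
  ∏-++ f []       ys = 𝕋.sym (𝕋.*-identityˡ _)
  ∏-++ f (x ∷ xs) ys = 𝕋.trans (𝕋.*-congˡ (∏-++ f xs ys)) (𝕋.sym (𝕋.*-assoc _ _ _))

  ∏-↭ : ∀ f {xs ys} → xs ↭ ys → ∏ f xs 𝕋.≈ ∏ f ys
  ∏-↭ f Perm.refl         = 𝕋.refl
  ∏-↭ f (prep x p)   = 𝕋.*-congˡ (∏-↭ f p)
  ∏-↭ f (swap x y p) = 𝕋.trans (𝕋.*-congˡ (𝕋.*-congˡ (∏-↭ f p)))
    (solve 3 (λ a b r → a :* (b :* r) := b :* (a :* r)) 𝕋.refl (f x) (f y) _)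
  ∏-↭ f (Perm.trans p q)  = 𝕋.trans (∏-↭ f p) (∏-↭ f q)

  ∏-scaled : ∀ {a xs ys} → Scaled a xs ys → ∏ lin xs 𝕋.≈ const a 𝕋.* ∏ lin ys
  ∏-scaled [] = 𝕋.sym (𝕋.trans (𝕋.*-congʳ (Hom.1-homo (cst n))) (𝕋.*-identityˡ _))
  ∏-scaled (_∷_ {a} {b} {x} {y} {xs} {ys} (_ , x≈ay) s) = begin
    lin x 𝕋.* ∏ lin xs                                ≈⟨ 𝕋.*-cong (𝕋.trans (lin-cong x (a ·ᵥ y) x≈ay) (lin-· a y)) (∏-scaled s) ⟩
    const a 𝕋.* lin y 𝕋.* (const b 𝕋.* ∏ lin ys)      ≈⟨ solve 4 (λ a y b r → a :* y :* (b :* r) := a :* b :* (y :* r)) 𝕋.refl (const a) (lin y) (const b) (∏ lin ys) ⟩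
    const a 𝕋.* const b 𝕋.* (lin y 𝕋.* ∏ lin ys)      ≈⟨ 𝕋.*-congʳ (const-* a b) ⟨
    const (a * b) 𝕋.* ∏ lin (y ∷ ys)                  ∎
    where open SetoidReasoning 𝕋.setoid

  norm-M : ∀ xs → norm n (M R n xs) 𝕋.≈ ∏ lin xs
  norm-M []       = Hom.1-homo (cst n)
  norm-M (x ∷ xs) = 𝕋.*-cong (norm-linP x) (norm-M xs)

  module _ {S I : List Form} (orth : Orth S I) (𝓕 : Flag I) (sep : Separator S I) where
    project : Form → Form
    project = apply (P sep)

    -- The condition that puts a form of L(T_q) into `V_q`.
    Visible : Form → Set (c ⊔ ℓ)
    Visible x = ¬ (Span (S ++ I) x × ¬ Span I x)

    -- The weight of a form is multiplicative under scaling, agrees with the form on the span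
    -- of S, and is the image modulo I for the forms outside V_q.
    Weight : Form → 𝕋.Carrier → Set (c ⊔ ℓ)
    Weight x r = (Visible x × Σ F λ a → Lead 𝓕 x a × r 𝕋.≈ const a) ⊎ (¬ Visible x × r 𝕋.≈ lin (project x))

    visible-unscale : ∀ {x y a} → x ∼[ a ] y → Visible x → Visible y
    visible-unscale x∼y v (s , ¬t) = v (span-scale x∼y s , λ t → ¬t (span-unscale x∼y t))

    visible-scale : ∀ {x y a} → x ∼[ a ] y → Visible y → Visible x
    visible-scale x∼y v (s , ¬t) = v (span-unscale x∼y s , λ t → ¬t (span-scale x∼y t))

    lead-nonzero : ∀ {x a} → Lead 𝓕 x a → ¬ x ≈ᵥ 0ᵥ
    lead-nonzero {x} l x≈0 = Lead.nonzero l (trans (Lead.value l) (fn-0 (Flag.h 𝓕 (Lead.pos l)) x x≈0))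

    lead-scale : ∀ {x y a b} → x ∼[ a ] y → Lead 𝓕 y b → Lead 𝓕 x (a * b)
    lead-scale {x} {y} {a} (a≉0 , x≈ay) l = lead-step 𝓕 0 a a≉0
      (λ i → trans (x≈ay i) (sym (trans (+ᵥ-at (a ·ᵥ y) 0ᵥ i) (trans (+-congˡ (0ᵥ-at i)) (+-identityʳ _)))))
      (span-0 []) (λ s → lead-nonzero l (span-[] s)) l

    project-scale : ∀ {x y a} → x ∼[ a ] y → project x ≈ᵥ a ·ᵥ project y
    project-scale {x} {y} {a} (_ , x≈ay) i = trans (apply-at (P sep) x i) (trans (cong (P sep i) x (a ·ᵥ y) x≈ay)
      (trans (·-homo (P sep i) a y) (sym (trans (·ᵥ-at a (project y) i) (*-congˡ (apply-at (P sep) y i))))))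

    weight-scale : ∀ {x y a r s} → x ∼[ a ] y → Weight x r → Weight y s → r 𝕋.≈ const a 𝕋.* s
    weight-scale {x} {a = a} x∼y (inj₁ (_ , b , l , r≈b)) (inj₁ (_ , d , m , s≈d)) = 𝕋.trans r≈b
      (𝕋.trans (Hom.cong (cst n) (lead-unique 𝓕 {u = x} {v = x} (λ i → refl) l (lead-scale x∼y m))) (𝕋.trans (const-* a d) (𝕋.*-congˡ (𝕋.sym s≈d))))
    weight-scale {x} {y} {a} x∼y (inj₂ (_ , r≈)) (inj₂ (_ , s≈)) = 𝕋.trans r≈
      (𝕋.trans (lin-cong (project x) (a ·ᵥ project y) (project-scale x∼y)) (𝕋.trans (lin-· a (project y)) (𝕋.*-congˡ (𝕋.sym s≈))))
    weight-scale x∼y (inj₁ (v , _)) (inj₂ (¬v , _)) = ⊥-elim (¬v (visible-unscale x∼y v))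
    weight-scale x∼y (inj₂ (¬v , _)) (inj₁ (v , _)) = ⊥-elim (¬v (visible-scale x∼y v))

    -- A visible form of sp(S) cannot fail to lie in sp(I), so orthogonality would make it zero; but
    -- a form with a leading coefficient is nonzero. Hence x is projected, and the projection fixes
    -- it.
    weight-keep : ∀ {x r} → Span S x → Weight x r → r 𝕋.≈ lin x
    weight-keep {x} s (inj₁ (v , a , l , _)) =
      ⊥-elim (v (span-++ˡ S I s , λ t → lead-nonzero l (orth x s t)))
    weight-keep {x} s (inj₂ (_ , r≈)) = 𝕋.trans r≈ (lin-cong (project x) x λ i → trans (apply-at (P sep) x i) (keeps sep x s i))

    -- Write x = u + w with u in sp(S) and w in sp(I). The projection is u, and if u were zero, x
    -- would lie in sp(I) and be visible.
    project-nonzero : ∀ {x} → ¬ Visible x → ¬ project x ≈ᵥ 0ᵥ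
    project-nonzero {x} ¬v z = ¬v λ (s , ¬t) → let u , w , su , sw , x≈ = span-++⁻ S I s in
      ¬t (span-cong (λ i → sym (trans (x≈ i) (trans (+ᵥ-at u w i) (trans (+-congʳ (begin
        lookup u i                                        ≈⟨ keeps sep u su i ⟨
        fn (P sep i) u                                    ≈⟨ +-identityʳ _ ⟨
        fn (P sep i) u + 0#                               ≈⟨ +-congˡ (kills sep w sw i) ⟨
        fn (P sep i) u + fn (P sep i) w                   ≈⟨ +-homo (P sep i) u w ⟨
        fn (P sep i) (u +ᵥ w)                             ≈⟨ cong (P sep i) x (u +ᵥ w) x≈ ⟨
        fn (P sep i) x                                    ≈⟨ apply-at (P sep) x i ⟨
        lookup (project x) i                              ≈⟨ trans (z i) (0ᵥ-at i) ⟩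
        0#                                                ∎)) (+-identityˡ _))))) sw)
      where open SetoidReasoning setoid

    weight-regular : ∀ {x r} → Weight x r → ¬ ¬ Regular (𝕋 n) r
    weight-regular (inj₁ (_ , a , l , r≈a)) = return (Regularity.regular-cong (𝕋 n) (𝕋.sym r≈a) (unit-cst n (Lead.nonzero l)))
    weight-regular {x} (inj₂ (¬v , r≈)) = do
      i , z ← nonzero-entry (project x) (project-nonzero ¬v)
      return (Regularity.regular-cong (𝕋 n) (𝕋.sym r≈) (lin-regular (project x) i z))

    data Weights : List Form → 𝕋.Carrier → Set (c ⊔ ℓ) where
      nil  : ∀ {r} → r 𝕋.≈ 𝕋.1# → Weights [] r
      cons : ∀ {x xs r s t} → Weight x r → Weights xs s → t 𝕋.≈ r 𝕋.* s → Weights (x ∷ xs) t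

    weights-↭ : ∀ {xs ys r} → xs ↭ ys → Weights xs r → Weights ys r
    weights-↭ Perm.refl         w             = w
    weights-↭ (prep x p)   (cons v w e)  = cons v (weights-↭ p w) e
    weights-↭ (swap x y p) (cons {r = a} v (cons {r = b} {s = d} v′ w e′) e) = cons v′ (cons v (weights-↭ p w) 𝕋.refl)
      (𝕋.trans e (𝕋.trans (𝕋.*-congˡ e′) (solve 3 (λ a b r → a :* (b :* r) := b :* (a :* r)) 𝕋.refl a b d)))
    weights-↭ (Perm.trans p q)  w             = weights-↭ q (weights-↭ p w)

    weights-++⁻ : ∀ xs {ys r} → Weights (xs ++ ys) r → ∃ λ a → ∃ λ b → Weights xs a × Weights ys b × r 𝕋.≈ a 𝕋.* b
    weights-++⁻ []       {r = r} w  = 𝕋.1# , r , nil 𝕋.refl , w , 𝕋.sym (𝕋.*-identityˡ r)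
    weights-++⁻ (x ∷ xs) (cons v w e) = let a , b , wa , wb , e′ = weights-++⁻ xs w in
      _ , b , cons v wa 𝕋.refl , wb , 𝕋.trans e (𝕋.trans (𝕋.*-congˡ e′) (𝕋.sym (𝕋.*-assoc _ a b)))

    weights-scaled : ∀ {a xs ys r s} → Scaled a xs ys → Weights xs r → Weights ys s → r 𝕋.≈ const a 𝕋.* s
    weights-scaled [] (nil r≈1) (nil s≈1) = 𝕋.trans r≈1 (𝕋.sym (𝕋.trans (𝕋.*-cong (Hom.1-homo (cst n)) s≈1) (𝕋.*-identityˡ _)))
    weights-scaled (_∷_ {a} {b} x∼y σ) (cons v w e) (cons {r = p} {s = q} v′ w′ e′) = 𝕋.trans e
      (𝕋.trans (𝕋.*-cong (weight-scale x∼y v v′) (weights-scaled σ w w′))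
      (𝕋.trans (solve 4 (λ a y b r → a :* y :* (b :* r) := a :* b :* (y :* r)) 𝕋.refl (const a) p (const b) q)
      (𝕋.*-cong (𝕋.sym (const-* a b)) (𝕋.sym e′))))

    weights-keep : ∀ {xs r} → All (Span S) xs → Weights xs r → r 𝕋.≈ ∏ lin xs
    weights-keep []       (nil e)      = e
    weights-keep (s ∷ ss) (cons v w e) = 𝕋.trans e (𝕋.*-cong (weight-keep s v) (weights-keep ss w))

    weights-regular : ∀ {xs r} → Weights xs r → ¬ ¬ Regular (𝕋 n) r
    weights-regular (nil e) = return (Regularity.regular-cong (𝕋 n) (𝕋.sym e)
      (Regularity.unit-regular (𝕋 n) {u = 𝕋.1#} (𝕋.*-identityˡ _)))
    weights-regular (cons v w e) = do
      ρ ← weight-regular v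
      σ ← weights-regular w
      return (Regularity.regular-cong (𝕋 n) (𝕋.sym e) (Regularity.*-regular (𝕋 n) ρ σ))

    -- The weight rescales the common part by the same `ratio` as the product of forms does, and
    -- leaves both rests alone. So both sides consist of `ratio`, the weight and the product of
    -- `common₂`, and the products of the two rests.
    weights-cross : ∀ {A B r s} → Alike S A B → Weights A r → Weights B s → s 𝕋.* ∏ lin A 𝕋.≈ ∏ lin B 𝕋.* r
    weights-cross {A} {B} {r} {s} al wA wB =
      let a₁ , b₁ , wa₁ , wb₁ , r≈ = weights-++⁻ common₁ (weights-↭ perm₁ wA)
          a₂ , b₂ , wa₂ , wb₂ , s≈ = weights-++⁻ common₂ (weights-↭ perm₂ wB)
      in begin
        s 𝕋.* ∏ lin A
          ≈⟨ 𝕋.*-cong (𝕋.trans s≈ (𝕋.*-congˡ (weights-keep rest₂⊆ wb₂)))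
               (𝕋.trans (∏-↭ lin perm₁) (𝕋.trans (∏-++ lin common₁ rest₁) (𝕋.*-congʳ (∏-scaled scaled)))) ⟩
        (a₂ 𝕋.* ∏ lin rest₂) 𝕋.* (const ratio 𝕋.* ∏ lin common₂ 𝕋.* ∏ lin rest₁)
          ≈⟨ solve 5 (λ a q k p t → (a :* q) :* (k :* p :* t) := (p :* q) :* (k :* a :* t)) 𝕋.refl a₂ (∏ lin rest₂) (const ratio) (∏ lin common₂) (∏ lin rest₁) ⟩
        (∏ lin common₂ 𝕋.* ∏ lin rest₂) 𝕋.* (const ratio 𝕋.* a₂ 𝕋.* ∏ lin rest₁)
          ≈⟨ 𝕋.*-cong (𝕋.trans (∏-↭ lin perm₂) (∏-++ lin common₂ rest₂))
               (𝕋.trans r≈ (𝕋.*-cong (weights-scaled scaled wa₁ wa₂) (weights-keep rest₁⊆ wb₁))) ⟨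
        ∏ lin B 𝕋.* r ∎
      where
      open Alike al
      open SetoidReasoning 𝕋.setoid

    -- The ring endomorphism that extends `project`, obtained by substituting the projected unit
    -- forms for the variables.
    reduce : Hom (𝕋 n) (𝕋 n)
    reduce = substitute (cst n) n (λ j → lin (project (unit (cst n) j)))

    reduce-lin : ∀ v → Hom.fn reduce (lin v) 𝕋.≈ lin (project v)
    reduce-lin v = 𝕋.trans (substitute-lin (cst n) n _ v) (𝕋.sym (linear-combine (cst n) (lin ∘ project)
      (λ u w p → lin-cong (project u) (project w) λ i → trans (apply-at (P sep) u i) (trans (cong (P sep i) u w p) (sym (apply-at (P sep) w i))))
      (λ u w → 𝕋.trans (lin-cong (project (u +ᵥ w)) (project u +ᵥ project w) λ i → trans (apply-at (P sep) (u +ᵥ w) i)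
         (trans (+-homo (P sep i) u w) (sym (trans (+ᵥ-at (project u) (project w) i) (+-cong (apply-at (P sep) u i) (apply-at (P sep) w i))))))
         (lin-+ (project u) (project w)))
      (λ a w → 𝕋.trans (lin-cong (project (a ·ᵥ w)) (a ·ᵥ project w) λ i → trans (apply-at (P sep) (a ·ᵥ w) i)
         (trans (·-homo (P sep i) a w) (sym (trans (·ᵥ-at a (project w) i) (*-congˡ (apply-at (P sep) w i))))))
         (lin-· a (project w))) v))

    reduce-const : ∀ a → Hom.fn reduce (const a) 𝕋.≈ const a
    reduce-const = substitute-cst (cst n) n _

    reduce-∏ : ∀ xs → Hom.fn reduce (∏ lin xs) 𝕋.≈ ∏ (lin ∘ project) xs
    reduce-∏ []       = Hom.1-homo reduce
    reduce-∏ (x ∷ xs) = 𝕋.trans (Hom.*-homo reduce _ _) (𝕋.*-cong (reduce-lin x) (reduce-∏ xs))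

    reduce-ideal : ∀ p → InIdeal R n I p → Hom.fn reduce (norm n p) 𝕋.≈ 𝕋.0#
    reduce-ideal p (gs , p≃) = 𝕋.trans (Hom.cong reduce (≃⇒norm n p (sumP R n (List.zipWith (λ g v → g ⊗ linP R n v) (Vec.toList gs) I)) p≃)) (go I gs (λ v s → s))
      where
      go : ∀ J (gs : Vec (Poly R n) (length J)) → (∀ v → Span J v → Span I v) →
           Hom.fn reduce (norm n (sumP R n (List.zipWith (λ g v → g ⊗ linP R n v) (Vec.toList gs) J))) 𝕋.≈ 𝕋.0#
      go []      []       _   = 𝕋.trans (reduce-const 0#) (Hom.0-homo (cst n))
      go (v ∷ J) (g ∷ gs) J⊆I = 𝕋.trans (Hom.+-homo reduce _ _) (𝕋.trans (𝕋.+-cong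
        (𝕋.trans (Hom.*-homo reduce _ _) (𝕋.trans (𝕋.*-congˡ (𝕋.trans (Hom.cong reduce (norm-linP v)) (𝕋.trans (reduce-lin v)
          -- The zero form is presented as `0# ·ᵥ v`, so that `lin-·` shows its polynomial to be
          -- zero.
          (𝕋.trans (lin-cong (project v) (0# ·ᵥ v) λ i → trans (apply-at (P sep) v i) (trans (kills sep v (J⊆I v (span-here v J)) i) (sym (trans (·ᵥ-at 0# v i) (zeroˡ _)))))
            (𝕋.trans (lin-· 0# v) (𝕋.trans (𝕋.*-congʳ (Hom.0-homo (cst n))) (𝕋.zeroˡ _))))))) (𝕋.zeroʳ _)))
        (go J gs (λ w s → J⊆I w (span-there s)))) (𝕋.+-identityˡ _))

    open MonoidSum *-commutativeMonoid using () renaming (sum to product; sum-permute to product-permute)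

    -- The flags decide visibility, so the weight of the whole list is obtained without double
    -- negation.
    weights-keepT : ∀ {m} (flags : Vec Bool m) (xs : Vec Form m) →
      (∀ i → (lookup flags i ≡ true) ⇔ Visible (lookup xs i)) →
      (e : Fin (length (keepT R n flags xs)) → F) → (∀ j → Lead 𝓕 (List.lookup (keepT R n flags xs) j) (e j)) →
      Weights (Vec.toList xs) (const (product e) 𝕋.* ∏ (lin ∘ project) (keepF R n flags xs))
    weights-keepT []            []       spec e l = nil (𝕋.trans (𝕋.*-identityʳ _) (Hom.1-homo (cst n)))
    weights-keepT (true  ∷ bs) (x ∷ xs) spec e l =
      cons (inj₁ (Equivalence.to (spec Fin.zero) ≡.refl , e Fin.zero , l Fin.zero , 𝕋.refl))
        (weights-keepT bs xs (spec ∘ Fin.suc) (e ∘ Fin.suc) (l ∘ Fin.suc))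
        (𝕋.trans (𝕋.*-congʳ (const-* _ _)) (𝕋.*-assoc _ _ _))
    weights-keepT (false ∷ bs) (x ∷ xs) spec e l =
      cons (inj₂ ((λ v → case Equivalence.from (spec Fin.zero) v of λ ()) , 𝕋.refl))
        (weights-keepT bs xs (spec ∘ Fin.suc) e l)
        (solve 3 (λ a b r → a :* (b :* r) := b :* (a :* r)) 𝕋.refl _ _ _)

    module _ {k d : ℕ} (C : Circuit R n k d) {V : List Form} (λ′ : Fin (length V) → F)
             (leads : ∀ u → Lead 𝓕 (List.lookup V u) (λ′ u)) where

      sc-product : ∀ {U W} (τ : OrdMatching R n I U W) (f : Fin (length U) → F) →
                   product (λ u → OrdMatching.d τ u * f u) ≈ sc τ * product f
      sc-product {U} τ f = trans (go (OrdMatching.d τ) f) (*-congʳ (reflexive (≡.sym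
          (≡.cong (List.foldr _*_ 1#) (List.map-tabulate id (OrdMatching.d τ))))))
        where
        go : ∀ {m} (g f : Fin m → F) → product (λ u → g u * f u) ≈ List.foldr _*_ 1# (List.tabulate g) * product f
        go {zero}  g f = sym (*-identityˡ 1#)
        go {suc m} g f = trans (*-congˡ (go (g ∘ Fin.suc) (f ∘ Fin.suc)))
          (solve′ 4 (λ a b x y → a ∶* b ∶* (x ∶* y) ∶= a ∶* x ∶* (b ∶* y)) refl _ _ _ _)
          where open NaturalCoefficients commutativeSemiring using () renaming (solve to solve′; _:*_ to _∶*_; _:=_ to _∶=_; _:+_ to _∶+_)

      -- A form of `V_q` has the leading coefficient of its partner in V times the factor of the
      -- matching. The factors multiply to `sc (τ B)`, and what remains, `product λ′`, is the same
      -- for every q.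
      block-weights : ∀ {q} (B : BlockData R n C S I V q) →
        Weights (Vec.toList (L C q)) (const (sc (τ B) * product λ′) 𝕋.* ∏ (lin ∘ project) (keepF R n (flags B) (L C q)))
      block-weights {q} B = weights-subst (𝕋.*-congʳ (Hom.cong (cst n) (trans (product-permute e π′)
          (trans (reflexive (product-cong λ u → ≡.cong (λ t → OrdMatching.d (τ B) t * λ′ t) (Inverse.strictlyInverseʳ π′ u))) (sc-product (τ B) λ′)))))
        (weights-keepT (flags B) (L C q) spec e leads′)
        where
        W = keepT R n (flags B) (L C q)
        π′ = OrdMatching.π (τ B)
        e : Fin (length W) → F
        e j = OrdMatching.d (τ B) (Inverse.from π′ j) * λ′ (Inverse.from π′ j)

        product-cong : ∀ {m} {f g : Fin m → F} → (∀ i → f i ≡ g i) → product f ≡ product g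
        product-cong {zero}  p = ≡.refl
        product-cong {suc m} p = ≡.cong₂ _*_ (p Fin.zero) (product-cong (p ∘ Fin.suc))

        weights-subst : ∀ {xs r s} → r 𝕋.≈ s → Weights xs r → Weights xs s
        weights-subst p (nil e)      = nil (𝕋.trans (𝕋.sym p) e)
        weights-subst p (cons v w e) = cons v w (𝕋.trans (𝕋.sym p) e)

        spec : ∀ i → (lookup (flags B) i ≡ true) ⇔ Visible (lookup (L C q) i)
        spec i = record
          { to = λ t (s , ¬u) → Equivalence.to (flags-spec B i) t (fromSpan s , λ u → ¬u (toSpan u))
          ; from = λ v → Equivalence.from (flags-spec B i) λ (s , ¬u) → v (toSpan s , λ u → ¬u (fromSpan u))
          ; to-cong = λ { ≡.refl → ≡.refl } ; from-cong = λ { ≡.refl → ≡.refl } }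

        leads′ : ∀ j → Lead 𝓕 (List.lookup W j) (e j)
        leads′ j = let u = Inverse.from π′ j
                       i , w , w∈ , u∉ , v≈ = OrdMatching.shape (τ B) u
          in lead-step 𝓕 i (OrdMatching.d (τ B) u) (OrdMatching.d≉0 (τ B) u)
               (≡.subst (λ t → List.lookup W t ≈ᵥ OrdMatching.d (τ B) u ·ᵥ List.lookup V u +ᵥ w) (Inverse.strictlyInverseˡ π′ j) v≈)
               (toSpan w∈) (λ s → u∉ (fromSpan s)) (leads u)

      module _ (q₀ : Fin k) (B₀ : BlockData R n C S I V q₀) where
        w₀ : 𝕋.Carrier
        w₀ = const (sc (τ B₀) * product λ′) 𝕋.* ∏ (lin ∘ project) (keepF R n (flags B₀) (L C q₀))

        L₀ : List Form
        L₀ = Vec.toList (L C q₀)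

        -- Multiplying T_q by the weight of L(T_q₀) trades its product of forms for its weight,
        -- which is the reduced summand up to scalars. The factor on the right does not depend on q,
        -- so summation over q produces a multiple of the reduced blocking relation.
        pick-cross : ∀ q b (B : b ≡ true → BlockData R n C S I V q) → (b ≡ true → Alike S (Vec.toList (L C q)) L₀) →
          w₀ 𝕋.* norm n (if b then T C q else con 0#) 𝕋.≈
          (∏ lin L₀ 𝕋.* const (product λ′)) 𝕋.* Hom.fn reduce (norm n (pick° R n b (λ e → summand (B e))))
        pick-cross q false B al = 𝕋.trans (𝕋.trans (𝕋.*-congˡ (Hom.0-homo (cst n))) (𝕋.zeroʳ _))
          (𝕋.sym (𝕋.trans (𝕋.*-congˡ (𝕋.trans (reduce-const 0#) (Hom.0-homo (cst n)))) (𝕋.zeroʳ _)))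
        pick-cross q true B al = begin
          w₀ 𝕋.* (const a 𝕋.* norm n (M R n Lq))
            ≈⟨ 𝕋.*-congˡ (𝕋.*-congˡ (norm-M Lq)) ⟩
          w₀ 𝕋.* (const a 𝕋.* ∏ lin Lq)
            ≈⟨ solve 3 (λ w a l → w :* (a :* l) := a :* (w :* l)) 𝕋.refl w₀ (const a) (∏ lin Lq) ⟩
          const a 𝕋.* (w₀ 𝕋.* ∏ lin Lq)
            ≈⟨ 𝕋.*-congˡ (weights-cross (al ≡.refl) (block-weights Bq) (block-weights B₀)) ⟩
          const a 𝕋.* (∏ lin L₀ 𝕋.* (const (s * product λ′) 𝕋.* Y))
            ≈⟨ 𝕋.*-congˡ (𝕋.*-congˡ (𝕋.*-congʳ (const-* s (product λ′)))) ⟩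
          const a 𝕋.* (∏ lin L₀ 𝕋.* (const s 𝕋.* const (product λ′) 𝕋.* Y))
            ≈⟨ solve 5 (λ a l s p y → a :* (l :* (s :* p :* y)) := l :* p :* (s :* a :* y)) 𝕋.refl (const a) (∏ lin L₀) (const s) (const (product λ′)) Y ⟩
          (∏ lin L₀ 𝕋.* const (product λ′)) 𝕋.* (const s 𝕋.* const a 𝕋.* Y)
            ≈⟨ 𝕋.*-congˡ (𝕋.trans (Hom.*-homo reduce _ _) (𝕋.*-cong (𝕋.trans (reduce-const _) (const-* s a))
                 (𝕋.trans (Hom.cong reduce (norm-M W)) (reduce-∏ W)))) ⟨
          (∏ lin L₀ 𝕋.* const (product λ′)) 𝕋.* Hom.fn reduce (norm n (summand Bq)) ∎
          where
          open SetoidReasoning 𝕋.setoid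
          Bq = B ≡.refl
          Lq = Vec.toList (L C q)
          a = α C q
          s = sc (τ Bq)
          W = keepF R n (flags Bq) (L C q)
          Y = ∏ (lin ∘ project) W

        norm-sumP : ∀ {j} {J : Set j} (xs : List J) f → norm n (sumP R n (List.map f xs)) 𝕋.≈ Sums.∑ (𝕋 n) xs (norm n ∘ f)
        norm-sumP []       f = Hom.0-homo (cst n)
        norm-sumP (x ∷ xs) f = 𝕋.+-congˡ (norm-sumP xs f)

        -- The sum multiplied by `w₀` is a multiple of the image of an element of the ideal, hence
        -- zero; `w₀` is regular as a product of weights.
        subset-vanishes : (Q : Subset k) (B : ∀ q → lookup Q q ≡ true → BlockData R n C S I V q) →
          (∀ q → lookup Q q ≡ true → Alike S (Vec.toList (L C q)) L₀) →
          InIdeal R n I (sumIn R n Q (λ q e → summand (B q e))) →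
          ¬ ¬ _≃_ R n (subsetSum R n Q (T C)) (con 0#)
        subset-vanishes Q B al ideal = do
          ρ ← weights-regular (block-weights B₀)
          return (norm⇒≃ n (subsetSum R n Q (T C)) (con 0#) (𝕋.trans (ρ _ (begin
            w₀ 𝕋.* norm n (subsetSum R n Q (T C))
              ≈⟨ 𝕋.*-congˡ (norm-sumP (List.allFin k) _) ⟩
            w₀ 𝕋.* ∑ (List.allFin k) (λ q → norm n (if lookup Q q then T C q else con 0#))
              ≈⟨ *-distribˡ-∑ (List.allFin k) w₀ _ ⟩
            ∑ (List.allFin k) (λ q → w₀ 𝕋.* norm n (if lookup Q q then T C q else con 0#))
              ≈⟨ ∑-cong (List.allFin k) (λ q → pick-cross q (lookup Q q) (B q) (al q)) ⟩
            ∑ (List.allFin k) (λ q → K 𝕋.* Hom.fn reduce (norm n (pick° R n (lookup Q q) (λ e → summand (B q e)))))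
              ≈⟨ *-distribˡ-∑ (List.allFin k) K _ ⟨
            K 𝕋.* ∑ (List.allFin k) (λ q → Hom.fn reduce (norm n (pick° R n (lookup Q q) (λ e → summand (B q e)))))
              ≈⟨ 𝕋.*-congˡ (𝕋.trans (Hom.cong reduce (norm-sumP (List.allFin k) _)) (HomSum.∑-homo reduce (List.allFin k) _)) ⟨
            K 𝕋.* Hom.fn reduce (norm n (sumIn R n Q (λ q e → summand (B q e))))
              ≈⟨ 𝕋.trans (𝕋.*-congˡ (reduce-ideal (sumIn R n Q (λ q e → summand (B q e))) ideal)) (𝕋.zeroʳ K) ⟩
            𝕋.0# ∎)) (𝕋.sym (Hom.0-homo (cst n)))))
          where
          open SetoidReasoning 𝕋.setoid
          open Sums (𝕋 n)
          K = ∏ lin L₀ 𝕋.* const (product λ′)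

-- Counting with undecidable predicates

-- A relation, since P cannot be tested; `count-unique` makes the number well defined, and
-- `count-exists` provides it under double negation.
data Count {a p} {A : Set a} (P : A → Set p) : List A → ℕ → Set (a ⊔ p) where
  []  : Count P [] 0
  hit : ∀ {x xs m} → P x → Count P xs m → Count P (x ∷ xs) (suc m)
  miss  : ∀ {x xs m} → ¬ P x → Count P xs m → Count P (x ∷ xs) m

module _ {a p} {A : Set a} {P : A → Set p} where
  count-exists : ∀ xs → ¬ ¬ (∃ λ m → Count P xs m)
  count-exists []       = return (0 , [])
  count-exists (x ∷ xs) = do
    m , κ ← count-exists xs
    yes px ← ¬¬-excluded-middle {A = P x}
      where no ¬px → return (m , miss ¬px κ)
    return (suc m , hit px κ)

  count-unique : ∀ {xs m m′} → Count P xs m → Count P xs m′ → m ≡ m′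
  count-unique []         []          = ≡.refl
  count-unique (hit px κ) (hit _ κ′)  = ≡.cong suc (count-unique κ κ′)
  count-unique (hit px κ) (miss ¬px κ′) = ⊥-elim (¬px px)
  count-unique (miss ¬px κ) (hit px κ′) = ⊥-elim (¬px px)
  count-unique (miss ¬px κ) (miss _ κ′)   = count-unique κ κ′

  count-↭ : ∀ {xs ys m} → xs ↭ ys → Count P xs m → Count P ys m
  count-↭ Perm.refl         κ                  = κ
  count-↭ (prep x σ)   (hit px κ)         = hit px (count-↭ σ κ)
  count-↭ (prep x σ)   (miss ¬px κ)         = miss ¬px (count-↭ σ κ)
  count-↭ (swap x y σ) (hit px (hit py κ)) = hit py (hit px (count-↭ σ κ))
  count-↭ (swap x y σ) (hit px (miss ¬py κ)) = miss ¬py (hit px (count-↭ σ κ))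
  count-↭ (swap x y σ) (miss ¬px (hit py κ)) = hit py (miss ¬px (count-↭ σ κ))
  count-↭ (swap x y σ) (miss ¬px (miss ¬py κ)) = miss ¬py (miss ¬px (count-↭ σ κ))
  count-↭ (Perm.trans σ τ)  κ                  = count-↭ τ (count-↭ σ κ)

  count-++ : ∀ {xs ys m m′} → Count P xs m → Count P ys m′ → Count P (xs ++ ys) (m ℕ.+ m′)
  count-++ []         κ′ = κ′
  count-++ (hit px κ) κ′ = hit px (count-++ κ κ′)
  count-++ (miss ¬px κ) κ′ = miss ¬px (count-++ κ κ′)

  count-tabulate : ∀ {k m} {f g : Fin k → A} → (∀ i → P (f i) ⇔ P (g i)) → Count P (List.tabulate f) m → Count P (List.tabulate g) m
  count-tabulate {zero}  e []         = []
  count-tabulate {suc k} e (hit px κ) = hit (Equivalence.to (e Fin.zero) px) (count-tabulate (e ∘ Fin.suc) κ)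
  count-tabulate {suc k} e (miss ¬px κ) = miss (¬px ∘ Equivalence.from (e Fin.zero)) (count-tabulate (e ∘ Fin.suc) κ)

  count-occurs : ∀ {xs m} → Count P xs (suc m) → ∃ λ x → x ∈ xs × P x
  count-occurs (hit {x = x} px κ) = x , here ≡.refl , px
  count-occurs (miss ¬px κ)         = let x , x∈ , px = count-occurs κ in x , there x∈ , px

  count-positive : ∀ {x xs m} → x ∈ xs → P x → Count P xs m → ∃ λ m′ → m ≡ suc m′
  count-positive _            px (hit {m = m} _ κ) = m , ≡.refl
  count-positive (here ≡.refl) px (miss ¬px κ)       = ⊥-elim (¬px px)
  count-positive (there x∈)   px (miss ¬px κ)        = count-positive x∈ px κ

-- Rearranging a sum in a commutative monoid, applied to lists under `++` up to `↭` with singletons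
-- as summands.
bijection-↭ : ∀ {a} {A : Set a} {k} (ys : List A) (π : Fin k ↔ Fin (length ys)) →
              ys ↭ List.tabulate (List.lookup ys ∘ Inverse.to π)
bijection-↭ {A = A} ys π =
  Perm.trans (↭-reflexive (≡.trans (≡.sym (List.tabulate-lookup ys)) (≡.sym (sum-tabulate (List.lookup ys)))))
    (Perm.trans (sum-permute ([_] ∘ List.lookup ys) π) (↭-reflexive (sum-tabulate (List.lookup ys ∘ Inverse.to π))))
  where
  open MonoidSum (++-commutativeMonoid {A = A}) using (sum; sum-permute)
  sum-tabulate : ∀ {k} (f : Fin k → A) → sum ([_] ∘ f) ≡ List.tabulate f
  sum-tabulate {zero}  f = ≡.refl
  sum-tabulate {suc k} f = ≡.cong (f Fin.zero ∷_) (sum-tabulate (f ∘ Fin.suc))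

-- Congruence modulo a span, and the partner of a form

module Congruence {c ℓ} (R : CommutativeRing c ℓ) (isField : IsField R) (n : ℕ) where
  open CommutativeRing R renaming (Carrier to F)
  open IsField isField
  open LinearAlgebra R isField n
  open Scaling R isField n
  open SetoidReasoning setoid
  open NaturalCoefficients commutativeSemiring using (solve; _:+_; _:*_; _:=_)

  -- Proportionality modulo sp(X). For X = I it relates a form to its image under an ordered
  -- matching; for X = S it is what the forms collected by the doubling must avoid.
  record Rel (X : List Form) (x y : Form) : Set (c ⊔ ℓ) where
    constructor rel
    field
      factor   : F
      offset   : Form
      factor≉0 : ¬ factor ≈ 0#
      offset∈  : Span X offset
      congruent : y ≈ᵥ factor ·ᵥ x +ᵥ offset

  inverse-nonzero : ∀ {a u} → a * u ≈ 1# → ¬ u ≈ 0#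
  inverse-nonzero au≈1 u≈0 = 0≉1 (trans (sym (trans (*-congˡ u≈0) (zeroʳ _))) au≈1)

  rel-∼ : ∀ {X x y a} → y ∼[ a ] x → Rel X x y
  rel-∼ {X} {x} {y} {a} (a≉0 , y≈ax) = rel a 0ᵥ a≉0 (span-0 X) λ i →
    trans (y≈ax i) (sym (trans (+ᵥ-at (a ·ᵥ x) 0ᵥ i) (trans (+-congˡ (0ᵥ-at i)) (+-identityʳ _))))

  rel-refl : ∀ {X x} → Rel X x x
  rel-refl {x = x} = rel-∼ (∼-refl x)

  rel-sym : ∀ {X x y} → Rel X x y → Rel X y x
  rel-sym {X} {x} {y} (rel a w a≉0 sw y≈) =
    let u , au≈1 = inverse a a≉0 in
    rel u ((- 1# * u) ·ᵥ w) (inverse-nonzero au≈1) (span-· _ sw) λ i → sym (begin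
      lookup (u ·ᵥ y +ᵥ (- 1# * u) ·ᵥ w) i
        ≈⟨ trans (combo-at u y ((- 1# * u) ·ᵥ w) i) (+-cong (*-congˡ (trans (y≈ i) (combo-at a x w i))) (·ᵥ-at (- 1# * u) w i)) ⟩
      u * (a * lookup x i + lookup w i) + - 1# * u * lookup w i
        ≈⟨ solve 5 (λ u a x w m → u :* (a :* x :+ w) :+ m :* u :* w := a :* u :* x :+ (u :* w :+ m :* (u :* w))) refl u a _ _ (- 1#) ⟩
      a * u * lookup x i + (u * lookup w i + - 1# * (u * lookup w i))
        ≈⟨ +-cong (trans (*-congʳ au≈1) (*-identityˡ _)) (+-neg _) ⟩
      lookup x i + 0#
        ≈⟨ +-identityʳ _ ⟩
      lookup x i ∎)

  rel-trans : ∀ {X x y z} → Rel X x y → Rel X y z → Rel X x z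
  rel-trans {X} {x} {y} {z} (rel a w a≉0 sw y≈) (rel b w′ b≉0 sw′ z≈) =
    rel (b * a) (b ·ᵥ w +ᵥ w′) (nonzero-* b≉0 a≉0) (span-+ (span-· b sw) sw′) λ i → begin
      lookup z i                                             ≈⟨ trans (z≈ i) (combo-at b y w′ i) ⟩
      b * lookup y i + lookup w′ i                           ≈⟨ +-congʳ (*-congˡ (trans (y≈ i) (combo-at a x w i))) ⟩
      b * (a * lookup x i + lookup w i) + lookup w′ i        ≈⟨ solve 5 (λ b a x w v → b :* (a :* x :+ w) :+ v := b :* a :* x :+ (b :* w :+ v)) refl b a _ _ _ ⟩
      b * a * lookup x i + (b * lookup w i + lookup w′ i)    ≈⟨ +-congˡ (combo-at b w w′ i) ⟨
      b * a * lookup x i + lookup (b ·ᵥ w +ᵥ w′) i           ≈⟨ combo-at (b * a) x (b ·ᵥ w +ᵥ w′) i ⟨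
      lookup ((b * a) ·ᵥ x +ᵥ (b ·ᵥ w +ᵥ w′)) i              ∎

  rel-mono : ∀ {X Y x y} → (∀ {v} → Span X v → Span Y v) → Rel X x y → Rel Y x y
  rel-mono X⊆Y (rel a w a≉0 sw y≈) = rel a w a≉0 (X⊆Y sw) y≈

  rel-span : ∀ {X x y} → Rel X x y → Span X x → Span X y
  rel-span (rel a w a≉0 sw y≈) sx = span-cong (λ i → sym (y≈ i)) (span-+ (span-· a sx) sw)

  -- From y = b x + s = a x + w follows (a - b) x = s - w. As x is outside sp(S ∪ I), a and b agree,
  -- so s = w lies in both spans and is zero.
  rel-orth : ∀ {S I x y} → Orth S I → ¬ Span (S ++ I) x → Rel S x y → Rel I x y → ¬ ¬ (∃ λ a → y ∼[ a ] x)
  rel-orth {S} {I} {x} {y} orth x∉ (rel b s _ ss y≈s) (rel a w a≉0 sw y≈w) = do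
    yes δ≈0 ← ¬¬-excluded-middle {A = a + - 1# * b ≈ 0#}
      where no δ≉0 → ⊥-elim (x∉ (span-unscale {x = (a + - 1# * b) ·ᵥ x} (δ≉0 , λ i → refl) (span-cong (λ i → sym (trans (·ᵥ-at _ x i) (trans (difference i)
                       (sym (trans (+ᵥ-at s ((- 1#) ·ᵥ w) i) (+-congˡ (·ᵥ-at (- 1#) w i)))))))
                       (span-+ (span-++ˡ S I ss) (span-· (- 1#) (span-++ʳ S I sw))))))
    let w≈0 = orth w (span-cong (λ i → s≈w i (trans (sym (difference i)) (trans (*-congʳ δ≈0) (zeroˡ _)))) ss) sw
    return (a , a≉0 , λ i → trans (y≈w i) (trans (+ᵥ-at (a ·ᵥ x) w i) (trans (+-congˡ (trans (w≈0 i) (0ᵥ-at i))) (+-identityʳ _))))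
    where
    difference : ∀ i → (a + - 1# * b) * lookup x i ≈ lookup s i + - 1# * lookup w i
    difference i = begin
      (a + - 1# * b) * X
        ≈⟨ solve 4 (λ a m b x → (a :+ m :* b) :* x := a :* x :+ m :* (b :* x)) refl a (- 1#) b X ⟩
      a * X + - 1# * (b * X)
        ≈⟨ +-congʳ (trans (sym (+-identityʳ _)) (+-congˡ (sym (+-neg W)))) ⟩
      a * X + (W + - 1# * W) + - 1# * (b * X)
        ≈⟨ +-congʳ (sym (+-assoc _ _ _)) ⟩
      a * X + W + - 1# * W + - 1# * (b * X)
        ≈⟨ +-congʳ (+-congʳ (trans (sym (trans (y≈w i) (combo-at a x w i))) (trans (y≈s i) (combo-at b x s i)))) ⟩
      b * X + lookup s i + - 1# * W + - 1# * (b * X)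
        ≈⟨ solve 4 (λ p s w q → p :+ s :+ w :+ q := s :+ w :+ (p :+ q)) refl (b * X) (lookup s i) (- 1# * W) (- 1# * (b * X)) ⟩
      lookup s i + - 1# * W + (b * X + - 1# * (b * X))
        ≈⟨ trans (+-congˡ (+-neg _)) (+-identityʳ _) ⟩
      lookup s i + - 1# * W ∎
      where
      X = lookup x i
      W = lookup w i

    s≈w : ∀ i → lookup s i + - 1# * lookup w i ≈ 0# → lookup s i ≈ lookup w i
    s≈w i z = begin
      lookup s i                                    ≈⟨ trans (sym (+-identityʳ _)) (+-congˡ (sym (trans (+-comm _ _) (+-neg _)))) ⟩
      lookup s i + (- 1# * lookup w i + lookup w i) ≈⟨ trans (sym (+-assoc _ _ _)) (+-congʳ z) ⟩
      0# + lookup w i                               ≈⟨ +-identityˡ _ ⟩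
      lookup w i                                    ∎

  record Decomposition (A B : List Form) : Set (c ⊔ ℓ) where
    field
      common₁ common₂ rest₁ rest₂ : List Form
      perm₁   : A ↭ common₁ ++ rest₁
      perm₂   : B ↭ common₂ ++ rest₂
      ratio   : F
      scaled  : Scaled ratio common₁ common₂
      coprime : ∀ {x y} → x ∈ rest₁ → y ∈ rest₂ → ¬ (∃ λ a → x ∼[ a ] y)

    rest : List Form
    rest = rest₁ ++ rest₂

    length-rest : length rest ℕ.≤ length A ℕ.+ length B
    length-rest = ≡.subst (ℕ._≤ length A ℕ.+ length B) (≡.sym (List.length-++ rest₁))
      (ℕ.+-mono-≤ (bound common₁ perm₁) (bound common₂ perm₂))
      where
      bound : ∀ {xs} ys {zs : List Form} → xs ↭ ys ++ zs → length zs ℕ.≤ length xs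
      bound ys {zs} σ = ≡.subst (length zs ℕ.≤_) (≡.sym (≡.trans (↭-length σ) (List.length-++ ys))) (ℕ.m≤n+m _ _)

  -- Greedy cancellation: a form that is proportional to nothing in the current B is proportional to
  -- nothing in `rest₂`, which is a part of it.
  decomposition : ∀ A B → ¬ ¬ Decomposition A B
  decomposition []      B = return record
    { common₁ = [] ; common₂ = [] ; rest₁ = [] ; rest₂ = B ; perm₁ = Perm.refl ; perm₂ = Perm.refl
    ; ratio = 1# ; scaled = [] ; coprime = λ () }
  decomposition (x ∷ A) B = do
    no ¬∃ ← ¬¬-excluded-middle {A = Any (λ y → ∃ λ a → x ∼[ a ] y) B}
      where yes ∃y → let y , y∈B , a , x∼y = find ∃y
                         ys , zs , B≡ = ∈-∃++ y∈B
                     in matched y a x∼y (Perm.trans (↭-reflexive B≡) (shift y ys zs))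
    δ ← decomposition A B
    let open Decomposition δ
    return record
      { common₁ = common₁ ; common₂ = common₂ ; rest₁ = x ∷ rest₁ ; rest₂ = rest₂
      ; perm₁ = Perm.trans (prep x perm₁) (↭-sym (shift x common₁ rest₁)) ; perm₂ = perm₂
      ; ratio = ratio ; scaled = scaled
      ; coprime = λ { (here ≡.refl) y∈ x∼y → ¬∃ (Any.map (λ { ≡.refl → x∼y }) (∈-resp-↭ (↭-sym perm₂) (∈-++⁺ʳ common₂ y∈)))
                    ; (there x∈) → coprime x∈ } }
    where
    matched : ∀ y a → x ∼[ a ] y → ∀ {B′} → B ↭ y ∷ B′ → ¬ ¬ Decomposition (x ∷ A) B
    matched y a x∼y {B′} σ = do
      δ ← decomposition A B′
      let open Decomposition δ
      return record
        { common₁ = x ∷ common₁ ; common₂ = y ∷ common₂ ; rest₁ = rest₁ ; rest₂ = rest₂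
        ; perm₁ = prep x perm₁ ; perm₂ = Perm.trans σ (prep y perm₂)
        ; ratio = a * ratio ; scaled = x∼y ∷ scaled ; coprime = coprime }

  ∼-sym : ∀ {x y a} → x ∼[ a ] y → ∃ λ b → y ∼[ b ] x
  ∼-sym {x} {y} {a} (a≉0 , x≈ay) = let u , au≈1 = inverse a a≉0 in
    u , inverse-nonzero au≈1 , λ i → sym (begin
      lookup (u ·ᵥ x) i        ≈⟨ trans (·ᵥ-at u x i) (*-congˡ (trans (x≈ay i) (·ᵥ-at a y i))) ⟩
      u * (a * lookup y i)     ≈⟨ solve 3 (λ u a y → u :* (a :* y) := a :* u :* y) refl u a _ ⟩
      a * u * lookup y i       ≈⟨ trans (*-congʳ au≈1) (*-identityˡ _) ⟩
      lookup y i               ∎)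

  module _ {I : List Form} (e : Form) where
    Class : Form → Set (c ⊔ ℓ)
    Class = Rel I e

    count-scaled : ∀ {a xs ys m} → Scaled a xs ys → Count Class xs m → Count Class ys m
    count-scaled []        []         = []
    count-scaled (x∼y ∷ σ) (hit px κ) = hit (rel-trans px (rel-sym (rel-∼ x∼y))) (count-scaled σ κ)
    count-scaled (x∼y ∷ σ) (miss ¬px κ) = miss (λ py → ¬px (rel-trans py (rel-∼ x∼y))) (count-scaled σ κ)

    count-matching : ∀ {V W m} → OrdMatching R n I V W → Count Class V m → Count Class W m
    count-matching {V} {W} τ κ = count-↭ (↭-sym (bijection-↭ W π′))
      (count-tabulate step (≡.subst (λ X → Count Class X _) (≡.sym (List.tabulate-lookup V)) κ))
      where
      π′ = OrdMatching.π τ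
      step : ∀ u → Class (List.lookup V u) ⇔ Class (List.lookup W (Inverse.to π′ u))
      step u = let j , w , w∈ , _ , v≈ = OrdMatching.shape τ u
                   related : Rel I (List.lookup V u) (List.lookup W (Inverse.to π′ u))
                   related = rel (OrdMatching.d τ u) w (OrdMatching.d≉0 τ u) (span-take j I (toSpan w∈)) v≈
        in record { to = λ p → rel-trans p related ; from = λ p → rel-trans p (rel-sym related)
                  ; to-cong = λ { ≡.refl → ≡.refl } ; from-cong = λ { ≡.refl → ≡.refl } }

    count-keepT : ∀ {m k} (flags : Vec Bool m) (xs : Vec Form m) → (∀ i → Class (lookup xs i) → lookup flags i ≡ true) →
      Count Class (keepT R n flags xs) k → Count Class (Vec.toList xs) k
    count-keepT []          []       f κ          = κ
    count-keepT (true ∷ bs)  (x ∷ xs) f (hit px κ) = hit px (count-keepT bs xs (f ∘ Fin.suc) κ)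
    count-keepT (true ∷ bs)  (x ∷ xs) f (miss ¬px κ) = miss ¬px (count-keepT bs xs (f ∘ Fin.suc) κ)
    count-keepT (false ∷ bs) (x ∷ xs) f κ          =
      miss (λ px → case f Fin.zero px of λ ()) (count-keepT bs xs (f ∘ Fin.suc) κ)

  module _ {k d : ℕ} {C : Circuit R n k d} {S I V : List Form} {q₁ q₂ : Fin k}
           (B₁ : BlockData R n C S I V q₁) (B₂ : BlockData R n C S I V q₂)
           (δ : Decomposition (Vec.toList (L C q₁)) (Vec.toList (L C q₂))) where
    open Decomposition δ

    -- No form in the class of e lies in sp(S ∪ I), so all such forms of L(T_q) are in `V_q`, and
    -- the matching carries the class over from V.
    count-block : ∀ {e q m} → ¬ Span (S ++ I) e → (B : BlockData R n C S I V q) →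
                  Count (Class {I} e) V m → Count (Class {I} e) (Vec.toList (L C q)) m
    count-block {e} {q} e∉ B κ = count-keepT e (flags B) (L C q)
      (λ i p → Equivalence.from (flags-spec B i) λ (s , _) → e∉ (rel-span (rel-mono (span-++ʳ S I) (rel-sym p)) (toSpan s)))
      (count-matching e (τ B) κ)

    -- The class of e modulo I is equally frequent in both lists, and equally frequent in
    -- the common parts, hence also in the two coprime rests.
    double : ∀ {e} → e ∈ rest → ¬ Span (S ++ I) e → ¬ ¬ (∃ λ e′ → e′ ∈ rest × Rel I e e′ × ¬ (∃ λ a → e′ ∼[ a ] e))
    double {e} e∈ e∉ = do
      v , κ ← count-exists {P = Class {I} e} V
      r₁ , ρ₁ ← count-exists {P = Class {I} e} rest₁
      r₂ , ρ₂ ← count-exists {P = Class {I} e} rest₂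
      m , μ ← count-exists {P = Class {I} e} common₁
      let e₁ = count-unique (count-↭ perm₁ (count-block e∉ B₁ κ)) (count-++ μ ρ₁)
          e₂ = count-unique (count-↭ perm₂ (count-block e∉ B₂ κ)) (count-++ (count-scaled e scaled μ) ρ₂)
          r₁≡r₂ = ℕ.+-cancelˡ-≡ m r₁ r₂ (≡.trans (≡.sym e₁) e₂)
      return (partner r₁≡r₂ ρ₁ ρ₂ (∈-++⁻ rest₁ e∈))
      where
      partner : ∀ {r₁ r₂} → r₁ ≡ r₂ → Count (Class {I} e) rest₁ r₁ → Count (Class {I} e) rest₂ r₂ → e ∈ rest₁ ⊎ e ∈ rest₂ →
                ∃ λ e′ → e′ ∈ rest × Rel I e e′ × ¬ (∃ λ a → e′ ∼[ a ] e)
      partner ≡.refl ρ₁ ρ₂ (inj₁ e∈₁) with count-positive e∈₁ rel-refl ρ₁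
      ... | _ , ≡.refl = let e′ , e′∈ , p = count-occurs ρ₂ in
        e′ , ∈-++⁺ʳ rest₁ e′∈ , p , λ (a , s) → coprime e∈₁ e′∈ (∼-sym s)
      partner ≡.refl ρ₁ ρ₂ (inj₂ e∈₂) with count-positive e∈₂ rel-refl ρ₂
      ... | _ , ≡.refl = let e′ , e′∈ , p = count-occurs ρ₁ in
        e′ , ∈-++⁺ˡ e′∈ , p , λ s → coprime e′∈ e∈₂ s

-- Finite combinatorics: multiplicities and pairs of indices

¬¬-All : ∀ {a p} {A : Set a} {P : A → Set p} (xs : List A) → (∀ {x} → x ∈ xs → ¬ ¬ P x) → ¬ ¬ All P xs
¬¬-All []       f = return []
¬¬-All (x ∷ xs) f = do
  p ← f (here ≡.refl)
  ps ← ¬¬-All xs (f ∘ there)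
  return (p ∷ ps)

^-distribʳ-* : ∀ k m n → (m ℕ.* n) ℕ.^ k ≡ m ℕ.^ k ℕ.* n ℕ.^ k
^-distribʳ-* zero    m n = ≡.refl
^-distribʳ-* (suc k) m n = ≡.trans (≡.cong (m ℕ.* n ℕ.*_) (^-distribʳ-* k m n)) (ℕ.[m*n]*[o*p]≡[m*o]*[n*p] m n (m ℕ.^ k) (n ℕ.^ k))

length-⊆ : ∀ {a} {A : Set a} {xs ys : List A} → AllPairs _≢_ xs → All (_∈ ys) xs → length xs ≤ length ys
length-⊆ []                 []             = z≤n
length-⊆ {ys = ys} (x≢ ∷ u) (x∈ ∷ xs⊆) with ∈-∃++ x∈
... | as , bs , ≡.refl = ≡.subst (suc _ ≤_) (≡.sym (≡.trans (List.length-++ as) (≡.trans (ℕ.+-suc (length as) (length bs)) (≡.cong suc (≡.sym (List.length-++ as))))))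
  (s≤s (length-⊆ u (All.zipWith (λ (x≢y , y∈) → drop (∈-++⁻ as y∈) x≢y) (x≢ , xs⊆))))
  where
  drop : ∀ {x y} → y ∈ as ⊎ y ∈ x ∷ bs → x ≢ y → y ∈ as ++ bs
  drop (inj₁ y∈)             x≢y = ∈-++⁺ˡ y∈
  drop (inj₂ (here ≡.refl)) x≢y = ⊥-elim (x≢y ≡.refl)
  drop (inj₂ (there y∈))    x≢y = ∈-++⁺ʳ as y∈

module Occurrences {a} {A : Set a} (_≟_ : DecidableEquality A) where
  occ : A → List A → ℕ
  occ p []       = 0
  occ p (x ∷ xs) with p ≟ x
  ... | yes _ = suc (occ p xs)
  ... | no  _ = occ p xs

  remove : A → List A → List A
  remove p []       = []
  remove p (x ∷ xs) with p ≟ x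
  ... | yes _ = remove p xs
  ... | no  _ = x ∷ remove p xs

  occ+remove : ∀ p xs → length xs ≡ occ p xs ℕ.+ length (remove p xs)
  occ+remove p []       = ≡.refl
  occ+remove p (x ∷ xs) with p ≟ x
  ... | yes _ = ≡.cong suc (occ+remove p xs)
  ... | no  _ = ≡.trans (≡.cong suc (occ+remove p xs)) (≡.sym (ℕ.+-suc _ _))

  occ-remove : ∀ p q xs → occ q (remove p xs) ≤ occ q xs
  occ-remove p q []       = z≤n
  occ-remove p q (x ∷ xs) with p ≟ x
  ... | yes _ with q ≟ x
  ...   | yes _ = ℕ.m≤n⇒m≤1+n (occ-remove p q xs)
  ...   | no  _ = occ-remove p q xs
  occ-remove p q (x ∷ xs) | no _ with q ≟ x
  ...   | yes _ = s≤s (occ-remove p q xs)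
  ...   | no  _ = occ-remove p q xs

  remove-⊆ : ∀ {p ps} xs → All (_∈ p ∷ ps) xs → All (_∈ ps) (remove p xs)
  remove-⊆ []       []         = []
  remove-⊆ {p} (x ∷ xs) (x∈ ∷ xs⊆) with p ≟ x
  ... | yes _ = remove-⊆ xs xs⊆
  ... | no p≢x with x∈
  ...   | here x≡p   = ⊥-elim (p≢x (≡.sym x≡p))
  ...   | there x∈ps = x∈ps ∷ remove-⊆ xs xs⊆

  -- The length is the sum of the multiplicities, and each value in `ps` contributes a factor of at
  -- most B. The bound is assumed for all p, so that it passes to the list with one value removed.
  2^length≤ : ∀ {B} ps xs → (∀ p → 2 ℕ.^ occ p xs ≤ B) → All (_∈ ps) xs → 2 ℕ.^ length xs ≤ B ℕ.^ length ps
  2^length≤ []       []      b []  = s≤s z≤n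
  2^length≤ []       (x ∷ _) b (() ∷ _)
  2^length≤ {B} (p ∷ ps) xs b xs⊆ = begin
    2 ℕ.^ length xs                                   ≡⟨ ≡.cong (2 ℕ.^_) (occ+remove p xs) ⟩
    2 ℕ.^ (occ p xs ℕ.+ length (remove p xs))         ≡⟨ ℕ.^-distribˡ-+-* 2 (occ p xs) _ ⟩
    2 ℕ.^ occ p xs ℕ.* 2 ℕ.^ length (remove p xs)     ≤⟨ ℕ.*-mono-≤ (b p) (2^length≤ ps (remove p xs)
                                                           (λ q → ℕ.≤-trans (ℕ.^-monoʳ-≤ 2 (occ-remove p q xs)) (b q)) (remove-⊆ xs xs⊆)) ⟩
    B ℕ.* B ℕ.^ length ps                             ∎
    where open ℕ.≤-Reasoning

pairs : ∀ k → List (Fin k × Fin k)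
pairs zero    = []
pairs (suc k) = List.map (λ j → Fin.zero , Fin.suc j) (List.allFin k) ++ List.map (λ (i , j) → Fin.suc i , Fin.suc j) (pairs k)

-- Splitting off the pairs that contain 0 is Pascal's rule.
length-pairs : ∀ k → length (pairs k) ≡ k choose 2
length-pairs zero    = ≡.refl
length-pairs (suc k) = begin
  length (pairs (suc k))                              ≡⟨ List.length-++ (List.map _ (List.allFin k)) ⟩
  length (List.map _ (List.allFin k)) ℕ.+ length (List.map _ (pairs k))
    ≡⟨ ≡.cong₂ ℕ._+_ (≡.trans (List.length-map _ (List.allFin k)) (List.length-tabulate id)) (≡.trans (List.length-map _ (pairs k)) (length-pairs k)) ⟩
  k ℕ.+ k choose 2                                    ≡⟨ ≡.cong (ℕ._+ k choose 2) (nC1≡n k) ⟨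
  k choose 1 ℕ.+ k choose 2                           ≡⟨ nCk+nC[k+1]≡[n+1]C[k+1] k 1 ⟩
  suc k choose 2                                      ∎
  where open ≡.≡-Reasoning

∈-pairs : ∀ {k} {i j : Fin k} → i Fin.< j → (i , j) ∈ pairs k
∈-pairs {i = Fin.zero}  {Fin.suc j} _         = ∈-++⁺ˡ (∈-map⁺ _ (∈-allFin j))
∈-pairs {i = Fin.suc i} {Fin.suc j} (s≤s i<j) = ∈-++⁺ʳ _ (∈-map⁺ _ (∈-pairs i<j))

-- Taking the least index of Q as reference makes every pair formed with it ordered.
first : ∀ {k} (Q : Subset k) → 1 ≤ ∣ Q ∣ → ∃ λ q₀ → lookup Q q₀ ≡ true × (∀ q → lookup Q q ≡ true → q₀ ≡ q ⊎ q₀ Fin.< q)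
first (true ∷ Q)  _ = Fin.zero , ≡.refl , λ { Fin.zero _ → inj₁ ≡.refl ; (Fin.suc q) _ → inj₂ (s≤s z≤n) }
first (false ∷ Q) p = let q₀ , e , f = first Q p in Fin.suc q₀ , e , λ where
  (Fin.suc q) t → case f q t of λ { (inj₁ ≡.refl) → inj₁ ≡.refl ; (inj₂ l) → inj₂ (s≤s l) }

omitted : ∀ {k} (Q : Subset k) → ∣ Q ∣ ℕ.< k → ∃ λ q → lookup Q q ≡ false
omitted (false ∷ Q) _       = Fin.zero , ≡.refl
omitted (true ∷ Q)  (s≤s p) = let q , e = omitted Q p in Fin.suc q , e

-- Doubling along the chain

module ChainBound {c ℓ} (R : CommutativeRing c ℓ) (isField : IsField R) (n : ℕ) where
  open LinearAlgebra R isField n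
  open Leading R isField n
  open Scaling R isField n
  open Cancellation R isField n
  open Congruence R isField n

  -- The invariant of the doubling. `apart` makes the forms distinct, so their number is at most the
  -- length of D; `outside` is what a form needs to have a partner.
  record Spread (S D X : List Form) : Set (c ⊔ ℓ) where
    constructor spread
    field
      members : All (_∈ D) X
      outside : All (¬_ ∘ Span S) X
      apart   : AllPairs (λ x y → ¬ Rel S x y) X

  spread-length : ∀ {S D X} → Spread S D X → length X ≤ length D
  spread-length (spread m _ a) = length-⊆ (AllPairs.map (λ { ¬r ≡.refl → ¬r rel-refl }) a) m

  -- For links that belong to another pair: a smaller span separates more.
  spread-drop : ∀ {S I D X} → Spread (S ++ I) D X → Spread S D X
  spread-drop {S} {I} (spread m o a) =
    spread m (All.map (_∘ span-++ˡ S I) o) (AllPairs.map (_∘ rel-mono (span-++ˡ S I)) a)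

  -- Each form is joined by its partner. The two share a class modulo sp(S ∪ I), so different
  -- couples stay apart, and `rel-orth` separates the two within a couple modulo sp(S).
  spread-double : ∀ {S I D} → Orth S I →
    (∀ {e} → e ∈ D → ¬ Span (S ++ I) e → ¬ ¬ (∃ λ e′ → e′ ∈ D × Rel I e e′ × ¬ (∃ λ a → e′ ∼[ a ] e))) →
    ∀ {X} → Spread (S ++ I) D X → ¬ ¬ (∃ λ Y → Spread S D Y × length Y ≡ 2 ℕ.* length X)
  spread-double {S} {I} {D} orth dbl {X} (spread m o a) = do
    Y , s , _ , l ← go m o a
    return (Y , s , l)
    where
    Apart : Form → List Form → Set (c ⊔ ℓ)
    Apart e = All (λ x → ¬ Rel (S ++ I) e x)

    lift : ∀ {x y} → Rel I x y → Rel (S ++ I) x y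
    lift = rel-mono (span-++ʳ S I)

    -- The clause on `Apart` lets the induction continue: a form apart from all of X is also apart
    -- from the partners added to X, so a new couple is apart from the earlier ones.
    go : ∀ {X} → All (_∈ D) X → All (¬_ ∘ Span (S ++ I)) X → AllPairs (λ x y → ¬ Rel (S ++ I) x y) X →
         ¬ ¬ (∃ λ Y → Spread S D Y × (∀ e → Apart e X → Apart e Y) × length Y ≡ 2 ℕ.* length X)
    go []       []       []       = return ([] , spread [] [] [] , (λ _ _ → []) , ≡.refl)
    go {e ∷ X} (e∈ ∷ m) (e∉ ∷ o) (e≁ ∷ a) = do
      Y , spread m′ o′ a′ , transfer , l ← go m o a
      e′ , e′∈ , e~e′ , e′≁e ← dbl e∈ e∉
      return (e ∷ e′ ∷ Y ,
        spread (e∈ ∷ e′∈ ∷ m′)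
               ((e∉ ∘ span-++ˡ S I) ∷ (λ s → e∉ (rel-span (lift (rel-sym e~e′)) (span-++ˡ S I s))) ∷ o′)
               (((λ r → rel-orth orth e∉ r e~e′ e′≁e) ∷ All.map (_∘ rel-mono (span-++ˡ S I)) (transfer e e≁)) ∷
                (All.map (_∘ rel-mono (span-++ˡ S I)) (transfer e′ (All.map (λ ¬r r → ¬r (rel-trans (lift e~e′) r)) e≁))) ∷ a′) ,
        (λ { f (f≁e ∷ f≁) → f≁e ∷ (λ r → f≁e (rel-trans r (lift (rel-sym e~e′)))) ∷ transfer f f≁ }) ,
        ≡.trans (≡.cong (suc ∘ suc) l) (≡.sym (ℕ.*-suc 2 (length X))))

  module _ {k d : ℕ} (C : Circuit R n k d) (minimal : IsMinimal R n C)
           -- The lists are taken in the order b, a because `Alike` compares T_q with the reference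
           -- T_q₀, whose index is the smaller one.
           (δ : ∀ a b → Decomposition (Vec.toList (L C b)) (Vec.toList (L C a))) where

    Pair : Set
    Pair = Fin k × Fin k

    differing : Pair → List Form
    differing (a , b) = Decomposition.rest (δ a b)

    -- A link plays one of two roles: at the last occurrence of its pair in the chain the form `e`
    -- starts a spread, and at earlier occurrences the two blocks over a common `V` double it.
    record Witness (S I : List Form) (p : Pair) : Set (c ⊔ ℓ) where
      field
        ordered : proj₁ p Fin.< proj₂ p
        {V}     : List Form
        block₁  : BlockData R n C S I V (proj₁ p)
        block₂  : BlockData R n C S I V (proj₂ p)
        {e}     : Form
        e∈      : e ∈ differing p
        e∉      : ¬ Span S e

    -- Otherwise the lists of all T_q with q ∈ Q agree outside the span of S, and the
    -- blocking relation becomes the vanishing of Σ_{q ∈ Q} T_q.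
    witness : ∀ {S I Q} → Independent S → Independent I → Orth S I → Blocking R n C S I Q → ¬ ¬ (∃ λ p → Witness S I p)
    witness {S} {I} {Q} indS indI orth (1<Q , Q<k , V , bd , ideal , _) none =
      contradiction id
      where
      q₀  = proj₁ (first Q (ℕ.<⇒≤ 1<Q))
      q₀∈ = proj₁ (proj₂ (first Q (ℕ.<⇒≤ 1<Q)))

      V-nonzero : ∀ u → ¬ List.lookup V u ≈ᵥ 0ᵥ
      V-nonzero u z = let j , _ , _ , u∉ , _ = OrdMatching.shape (τ (bd q₀ q₀∈)) u in
        u∉ (fromSpan (span-cong {v = List.lookup V u} (λ i → sym (z i)) (span-0 (take j I))))
        where open CommutativeRing R using (sym)

      -- Membership in Q stays inside the double negation, so that the choice can be made over all
      -- of `Fin k`.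
      alike′ : ∀ q → ¬ ¬ (lookup Q q ≡ true → Alike S (Vec.toList (L C q)) (Vec.toList (L C q₀)))
      alike′ q with lookup Q q Bool.≟ true
      ... | no q∉  = return λ q∈ → ⊥-elim (q∉ q∈)
      ... | yes q∈ with proj₂ (proj₂ (first Q (ℕ.<⇒≤ 1<Q))) q q∈
      ...   | inj₁ ≡.refl = return λ _ → alike-refl S _
      ...   | inj₂ q₀<q   = do
        inside ← ¬¬-All (differing (q₀ , q)) λ e∈ e∉ → none ((q₀ , q) , record
          { ordered = q₀<q ; block₁ = bd q₀ q₀∈ ; block₂ = bd q q∈ ; e∈ = e∈ ; e∉ = e∉ })
        let open Decomposition (δ q₀ q)
        return λ _ → record
          { common₁ = common₁ ; common₂ = common₂ ; rest₁ = rest₁ ; rest₂ = rest₂ ; perm₁ = perm₁ ; perm₂ = perm₂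
          ; ratio = ratio ; scaled = scaled ; rest₁⊆ = All.++⁻ˡ rest₁ inside ; rest₂⊆ = All.++⁻ʳ rest₁ inside }

      contradiction : ¬ ¬ ⊥
      contradiction = do
        _ , sep ← separator S I (independent-++ indS indI orth)
        𝓕 ← flag indI
        leads ← ¬¬-∀-Fin {m = length V} (λ u → lead-exists 𝓕 (List.lookup V u) (V-nonzero u))
        alike ← ¬¬-∀-Fin alike′
        vanishes ← subset-vanishes orth 𝓕 sep C (proj₁ ∘ leads) (proj₂ ∘ leads) q₀ (bd q₀ q₀∈) Q bd alike ideal
        return (minimal Q (q₀ , q₀∈) (omitted Q Q<k) vanishes)

    data Witnesses : List Form → List Pair → Set (c ⊔ ℓ) where
      []  : ∀ {S} → Witnesses S []
      _∷_ : ∀ {S I p ps} → Orth S I × Witness S I p → Witnesses (S ++ I) ps → Witnesses S (p ∷ ps)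

    witnesses : ∀ {S 𝒯} → Independent S → ChainFrom R n C S 𝒯 → ¬ ¬ (∃ λ ps → Witnesses S ps × length ps ≡ length 𝒯)
    witnesses indS [] = return ([] , [] , ≡.refl)
    witnesses {S} indS (_∷_ {I = I} {Q = Q} (li , orth , blocking) chain) = do
      let indI  = linIndep⇒independent I li
          orth′ : Orth S I
          orth′ v s t = orth v (fromSpan s) (fromSpan t)
      p , w ← witness {Q = Q} indS indI orth′ blocking
      ps , ws , l ← witnesses (independent-++ indS indI orth′) chain
      return (p ∷ ps , (orth′ , w) ∷ ws , ≡.cong suc l)

    open Occurrences (Product.≡-dec (Fin._≟_ {k}) (Fin._≟_ {k}))

    -- The tail of the chain yields a spread modulo sp(S ∪ I). A link of the same pair doubles it
    -- into one modulo sp(S), and any other link merely passes to the smaller span.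
    spreads : ∀ {S ps} → Witnesses S ps → ∀ p r → occ p ps ≡ suc r → ¬ ¬ (∃ λ X → Spread S (differing p) X × length X ≡ 2 ℕ.^ r)
    spreads (_∷_ {S} {I} {p′} {ps} (orth , w) ws) p r eq with Product.≡-dec Fin._≟_ Fin._≟_ p p′
    ... | no _ = do
      X , s , l ← spreads ws p r eq
      return (X , spread-drop s , l)
    spreads (_∷_ {S} {I} {p′} {ps} (orth , w) ws) p zero    eq | yes ≡.refl =
      return ([ Witness.e w ] , spread (Witness.e∈ w ∷ []) (Witness.e∉ w ∷ []) ([] ∷ []) , ≡.refl)
    spreads (_∷_ {S} {I} {p′} {ps} (orth , w) ws) p (suc r) eq | yes ≡.refl = do
      X , s , l ← spreads ws p r (ℕ.suc-injective eq)
      Y , t , l′ ← spread-double orth (double (Witness.block₂ w) (Witness.block₁ w) (δ _ _)) s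
      return (Y , t , ≡.trans l′ (≡.cong (2 ℕ.*_) l))

    length-differing : ∀ p → length (differing p) ≤ d ℕ.+ d
    length-differing (a , b) = ≡.subst (length (differing (a , b)) ≤_)
      (≡.cong₂ ℕ._+_ (Vec.length-toList (L C b)) (Vec.length-toList (L C a))) (Decomposition.length-rest (δ a b))

    2^occ≤4d : ∀ {S ps} → 1 ≤ d → Witnesses S ps → ∀ p → 2 ℕ.^ occ p ps ≤ 4 ℕ.* d
    2^occ≤4d {ps = ps} 1≤d ws p with occ p ps in eq
    -- A pair that is never chosen contributes 2^0 = 1, and this is where `1 ≤ d` enters.
    ... | zero  = ℕ.≤-trans 1≤d (ℕ.m≤m+n d _)
    ... | suc r = decidable-stable (2 ℕ.^ suc r ℕ.≤? 4 ℕ.* d) do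
      X , s , l ← spreads ws p r eq
      return (begin
        2 ℕ.* 2 ℕ.^ r      ≡⟨ ≡.cong (2 ℕ.*_) l ⟨
        2 ℕ.* length X     ≤⟨ ℕ.*-monoʳ-≤ 2 (ℕ.≤-trans (spread-length s) (length-differing p)) ⟩
        2 ℕ.* (d ℕ.+ d)    ≡⟨ ≡.cong (λ x → 2 ℕ.* (d ℕ.+ x)) (ℕ.+-identityʳ d) ⟨
        2 ℕ.* (2 ℕ.* d)    ≡⟨ ℕ.*-assoc 2 2 d ⟨
        4 ℕ.* d            ∎)
      where open ℕ.≤-Reasoning

    all-pairs : ∀ {S ps} → Witnesses S ps → All (_∈ pairs k) ps
    all-pairs []             = []
    all-pairs ((_ , w) ∷ ws) = ∈-pairs (Witness.ordered w) ∷ all-pairs ws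

    chain-bound : ∀ {𝒯} → 1 ≤ d → Chain R n C 𝒯 → LengthBound k d (length 𝒯)
    chain-bound {𝒯} 1≤d chain = decidable-stable (2 ℕ.^ length 𝒯 ℕ.≤? _) do
      ps , ws , l ← witnesses [] chain
      return (begin
        2 ℕ.^ length 𝒯                                    ≡⟨ ≡.cong (2 ℕ.^_) l ⟨
        2 ℕ.^ length ps                                   ≤⟨ 2^length≤ (pairs k) ps (2^occ≤4d 1≤d ws) (all-pairs ws) ⟩
        (4 ℕ.* d) ℕ.^ length (pairs k)                    ≡⟨ ≡.cong ((4 ℕ.* d) ℕ.^_) (length-pairs k) ⟩
        (4 ℕ.* d) ℕ.^ N                                   ≡⟨ ^-distribʳ-* N 4 d ⟩
        4 ℕ.^ N ℕ.* d ℕ.^ N                               ≡⟨ ≡.cong (ℕ._* d ℕ.^ N) (ℕ.^-*-assoc 2 2 N) ⟩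
        -- The exponent `2 * N` obtained from `4 ^ N` is relaxed to the stated `(k ∸ 1) + 3 * N`.
        2 ℕ.^ (2 ℕ.* N) ℕ.* d ℕ.^ N                       ≤⟨ ℕ.*-monoˡ-≤ (d ℕ.^ N) (ℕ.^-monoʳ-≤ 2 (ℕ.≤-trans (ℕ.m≤n+m (2 ℕ.* N) N) (ℕ.m≤n+m (3 ℕ.* N) (k ℕ.∸ 1)))) ⟩
        2 ℕ.^ ((k ℕ.∸ 1) ℕ.+ 3 ℕ.* N) ℕ.* d ℕ.^ N         ∎)
      where
      open ℕ.≤-Reasoning
      N = k choose 2

theorem5 : ∀ {c ℓ : Level} (F : CommutativeRing c ℓ) → IsField F →
    (n k d : ℕ) → 1 ≤ k → 1 ≤ d →
    (C : Circuit F n k d) →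
    IsSimple F n C → IsMinimal F n C → IsIdentity F n C →
    (𝒯 : List (List (LinForm F n) × Subset k)) →
    Chain F n C 𝒯 → IsMaximal F n C 𝒯 →
    LengthBound k d (length 𝒯)
theorem5 F isField n k d 1≤k 1≤d C simple minimal identity 𝒯 chain maximal =
  decidable-stable (2 ℕ.^ length 𝒯 ℕ.≤? _) do
    -- The cancellations are fixed once for the whole chain: all links with the same pair have to
    -- double within one and the same list D(a,b).
    δ ← ¬¬-∀-Fin λ a → ¬¬-∀-Fin λ b → Congruence.decomposition F isField n (Vec.toList (L C b)) (Vec.toList (L C a))
    return (ChainBound.chain-bound F isField n C minimal δ 1≤d chain)
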